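{- For every constant $\lambda$ with $0<\lambda<1$, the generalized work function algorithm $\mathrm{WFA}_\lambda$ is constant competitive for the CNN problem; that is, there are constants $c\geq 1$ and $c_0$ (depending only on $\lambda$) such that for every origin and every finite request sequence $\rho$, the total distance travelled by $\mathrm{WFA}_\lambda$ (with any choice among minimizers at each step) is at most $c\cdot \mathrm{Opt}_\rho + c_0$.
   Context: The CNN problem: a single server moves in $\mathbb{R}^2$ with the metric $d((x_1,y_1),(x_2,y_2))=|x_1-x_2|+|y_1-y_2|$, starting at a given origin $\mathcal{O}\in\mathbb{R}^2$. Requests arrive online; a request is given by a point $(a,b)\in\mathbb{R}^2$ and corresponds to the set $r(a,b)=\{(x,y)\in\mathbb{R}^2: x=a \text{ or } y=b\}$; it is served by moving the server to some point of $r(a,b)$, without knowledge of future requests. The cost is the total travelled distance; $\mathrm{Opt}_\rho$ is the minimum cost of a path starting at $\mathcal{O}$ that visits, in order, a point of each request of $\rho$. For a request sequence $\sigma=r_1,\dots,r_n$ the work function $W_\sigma(s)$ is the minimum of $d(\mathcal{O},s_1)+\sum_{i=1}^{n-1}d(s_i,s_{i+1})+d(s_n,s)$ over $s_i\in r_i$ (for the empty sequence, $W(s)=d(\mathcal{O},s)$). The algorithm $\mathrm{WFA}_\lambda$: if after serving $\sigma$ the server is at $s$ and a new request $r$ arrives, it moves to any point $s'\in\mathrm{Argmin}_{t\in\mathbb{R}^2}\{W_{\sigma,r}(t)+\lambda d(s,t)\}$. An algorithm is $c$-competitive if there is a constant $c_0$ such that its cost on every instance is at most $c$ times the optimal cost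 plus $c_0$. -}

module Defs where

open import Level using (0ℓ)
open import Data.Product using (Σ; ∃; _×_; _,_)
open import Data.Sum using (_⊎_)
open import Data.List using (List; []; _∷_; _++_; [_])
open import Data.List.Relation.Binary.Pointwise using (Pointwise)
open import Relation.Binary.PropositionalEquality using (_≡_; _≢_)
open import Relation.Nullary using (Dec; yes; no)

-- The real numbers, axiomatised as a complete ordered field
-- (unique up to isomorphism, so quantifying over all models is the same as
-- working in ℝ).
record RealField : Set₁ where
  infixl 6 _+_ _-_
  infixl 7 _*_
  infix 4 _≤_
  field
    Carrier : Set
    0r 1r : Carrier
    _+_ _*_ : Carrier → Carrier → Carrier
    -_ : Carrier → Carrier
    _≤_ : Carrier → Carrier → Set
    +-assoc : ∀ x y z → (x + y) + z ≡ x + (y + z)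
    +-comm : ∀ x y → x + y ≡ y + x
    +-identityˡ : ∀ x → 0r + x ≡ x
    +-inverseʳ : ∀ x → x + (- x) ≡ 0r
    *-assoc : ∀ x y z → (x * y) * z ≡ x * (y * z)
    *-comm : ∀ x y → x * y ≡ y * x
    *-identityˡ : ∀ x → 1r * x ≡ x
    distribˡ : ∀ x y z → x * (y + z) ≡ (x * y) + (x * z)
    0≢1 : 0r ≢ 1r
    *-inverse : ∀ x → x ≢ 0r → ∃ λ y → x * y ≡ 1r
    ≤-refl : ∀ x → x ≤ x
    ≤-trans : ∀ {x y z} → x ≤ y → y ≤ z → x ≤ z
    ≤-antisym : ∀ {x y} → x ≤ y → y ≤ x → x ≡ y
    ≤-total : ∀ x y → x ≤ y ⊎ y ≤ x
    _≤?_ : ∀ x y → Dec (x ≤ y)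
    +-mono-≤ : ∀ {x y} z → x ≤ y → x + z ≤ y + z
    *-nonneg : ∀ {x y} → 0r ≤ x → 0r ≤ y → 0r ≤ x * y
    lub : (P : Carrier → Set) → ∃ P → (∃ λ b → ∀ x → P x → x ≤ b) →
          ∃ λ s → (∀ x → P x → x ≤ s) × (∀ b → (∀ x → P x → x ≤ b) → s ≤ b)

  _-_ : Carrier → Carrier → Carrier
  x - y = x + (- y)

  _<_ : Carrier → Carrier → Set
  x < y = (x ≤ y) × (x ≢ y)

  ∣_∣ : Carrier → Carrier
  ∣ x ∣ with 0r ≤? x
  ... | yes _ = x
  ... | no _ = - x

module CNN (ℝ : RealField) where
  open RealField ℝ

  Point : Set
  Point = Carrier × Carrier

  d : Point → Point → Carrier
  d (x₁ , y₁) (x₂ , y₂) = ∣ x₁ - x₂ ∣ + ∣ y₁ - y₂ ∣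

  Request : Set
  Request = Point

  InReq : Point → Request → Set
  InReq (x , y) (a , b) = (x ≡ a) ⊎ (y ≡ b)

  Serves : List Point → List Request → Set
  Serves ss σ = Pointwise InReq ss σ

  costTo : Point → List Point → Point → Carrier
  costTo a [] s = d a s
  costTo a (x ∷ xs) s = d a x + costTo x xs s

  pathCost : Point → List Point → Carrier
  pathCost a [] = 0r
  pathCost a (x ∷ xs) = d a x + pathCost x xs

  IsWork : Point → List Request → Point → Carrier → Set
  IsWork O σ s w =
    (∃ λ ss → Serves ss σ × costTo O ss s ≡ w) ×
    (∀ ss → Serves ss σ → w ≤ costTo O ss s)

  IsOpt : Point → List Request → Carrier → Set
  IsOpt O ρ v =
    (∃ λ ss → Serves ss ρ × pathCost O ss ≡ v) ×
    (∀ ss → Serves ss ρ → v ≤ pathCost O ss)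

  WFAStep : Carrier → Point → List Request → Point → Request → Point → Set
  WFAStep λ′ O σ s r s′ =
    ∃ λ w → IsWork O (σ ++ [ r ]) s′ w ×
      (∀ t w′ → IsWork O (σ ++ [ r ]) t w′ → w + λ′ * d s s′ ≤ w′ + λ′ * d s t)

  data WFARun (λ′ : Carrier) (O : Point) : List Request → Point → List Request → Carrier → Set where
    done : ∀ {σ s} → WFARun λ′ O σ s [] 0r
    step : ∀ {σ s r ρ s′ c} → WFAStep λ′ O σ s r s′ →
           WFARun λ′ O (σ ++ [ r ]) s′ ρ c →
           WFARun λ′ O σ s (r ∷ ρ) (d s s′ + c)

{-# OPTIONS --safe #-}
-- Let W be the work function and s the server.  Since s minimises W + λ d(s₀, ·), it satisfies
-- W s ≤ W t + λ d(s, t) for all t, and up to the change of W s the next move costs at most 2 D / λ,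
-- where D is the distance of s to the request.  It remains to bound the sum of the D.
--
-- While the optimal server rests at p, all requests pass through p; let V and H be the two lines
-- through p, and let μ lie between λ and 1.  The potential is a sum of upper bounds for slacks of
-- W with slope μ: of the points of V and of H against p (M), of all points against V and against
-- H (E), and of pairs of points against p and each other (Q).  Let the new request contain V.
-- If the previous one did too, then the values of W off V rise, and E of V decreases by a
-- multiple of D.  If the previous one contained H, then the two requests meet only in p and in one
-- further point, so that all other points rise, and Q or one of the E decreases.  Here E of H
-- may increase, but M + E of H does not.  When the optimal server moves, the potential changes
-- by a multiple of the distance, because all slacks are Lipschitz.
module Submission where

open import Defs
open import Algebra.Bundles using (CommutativeRing)
open import Algebra.Consequences.Propositional using (comm∧idˡ⇒id; comm∧invʳ⇒inv)
open import Data.Bool using (Bool; true; false; T; not; _xor_; if_then_else_)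
open import Data.Bool.Properties using (T-≡)
open import Data.Char.Base using (Char; toℕ)
open import Data.Empty using (⊥-elim)
open import Data.List using (List; []; _∷_; _++_; [_]; foldl)
open import Data.List.Relation.Binary.Pointwise using ([]; _∷_)
open import Data.Nat using (ℕ; zero; suc; _≡ᵇ_; _<ᵇ_; _∸_; _⊔_)
open import Data.Product using (∃; _×_; _,_; proj₁; proj₂)
open import Data.String.Base using (String; toList)
open import Data.Sum using (_⊎_; inj₁; inj₂; swap)
open import Data.Unit using (⊤)
open import Function using (flip)
open import Function.Bundles using (Equivalence)
open import Level using (0ℓ)
open import Relation.Binary.PropositionalEquality using (_≡_; _≢_; refl; sym; trans; cong; cong₂; subst; subst₂; isEquivalence)
open import Relation.Nullary using (yes; no)

-- Deciding polynomial identities by computation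

-- A polynomial is a formal sum of signed monomials, a monomial the sorted list of
-- its variables.  Integer coefficients are repetitions of a monomial.

data Expr : Set where
  var : ℕ → Expr
  0ᵉ 1ᵉ : Expr
  _+ᵉ_ _*ᵉ_ : Expr → Expr → Expr
  -ᵉ_ : Expr → Expr

Monomial : Set
Monomial = List ℕ

Poly : Set
Poly = List (Bool × Monomial)

insert : ℕ → Monomial → Monomial
insert i [] = i ∷ []
insert i (j ∷ m) = if i <ᵇ j then i ∷ j ∷ m else j ∷ insert i m

mulMono : Monomial → Monomial → Monomial
mulMono [] n = n
mulMono (i ∷ m) n = insert i (mulMono m n)

negate : Poly → Poly
negate [] = []
negate ((s , m) ∷ p) = (not s , m) ∷ negate p

mulTerm : Bool → Monomial → Poly → Poly
mulTerm s m [] = []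
mulTerm s m ((t , n) ∷ p) = (s xor t , mulMono m n) ∷ mulTerm s m p

mul : Poly → Poly → Poly
mul [] q = []
mul ((s , m) ∷ p) q = mulTerm s m q ++ mul p q

normalize : Expr → Poly
normalize (var i) = (false , i ∷ []) ∷ []
normalize 0ᵉ = []
normalize 1ᵉ = (false , []) ∷ []
normalize (e +ᵉ f) = normalize e ++ normalize f
normalize (e *ᵉ f) = mul (normalize e) (normalize f)
normalize (-ᵉ e) = negate (normalize e)

eqMono : Monomial → Monomial → Bool
eqMono [] [] = true
eqMono (i ∷ m) (j ∷ n) = if i ≡ᵇ j then eqMono m n else false
eqMono _ _ = false

opposite : Bool → Bool → Bool
opposite true false = true
opposite false true = true
opposite _ _ = false

-- Either cancels the signed monomial against an opposite one, or appends it.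
cancel : Bool → Monomial → Poly → Poly
cancel s m [] = (s , m) ∷ []
cancel s m ((t , n) ∷ p) =
  if opposite s t then (if eqMono m n then p else (t , n) ∷ cancel s m p)
  else (t , n) ∷ cancel s m p

reduced : Poly → Poly
reduced [] = []
reduced ((s , m) ∷ p) = cancel s m (reduced p)

null : Poly → Bool
null [] = true
null (_ ∷ _) = false

-- Claims are written "l r L R", where each term is in postfix notation: letters stand for the
-- atoms of the goal, and - is negation.
unary : (Expr → Expr) → List Expr → List Expr
unary op (e ∷ stack) = op e ∷ stack
unary op stack = stack

binary : (Expr → Expr → Expr) → List Expr → List Expr
binary op (f ∷ e ∷ stack) = op e f ∷ stack
binary op stack = stack

push : List Expr → Char → List Expr
push stack c =
  if toℕ c ≡ᵇ blank then stack else
  if toℕ c ≡ᵇ plus then binary _+ᵉ_ stack else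
  if toℕ c ≡ᵇ times then binary _*ᵉ_ stack else
  if toℕ c ≡ᵇ minus then unary -ᵉ_ stack else
  if toℕ c ≡ᵇ digit0 then 0ᵉ ∷ stack else
  if toℕ c ≡ᵇ digit1 then 1ᵉ ∷ stack else
  var (toℕ c ∸ a) ∷ stack
  where
  blank = 32
  plus = 43
  times = 42
  minus = 45
  digit0 = 48
  digit1 = 49
  a = 97

variables : Expr → ℕ
variables (var i) = suc i
variables 0ᵉ = 0
variables 1ᵉ = 0
variables (e +ᵉ f) = variables e ⊔ variables f
variables (e *ᵉ f) = variables e ⊔ variables f
variables (-ᵉ e) = variables e

-- L ≤ R implies l ≤ r, because r + L = l + R.
record Claim : Set where
  constructor claim
  field
    l r L R : Expr

  identity : Expr
  identity = (r +ᵉ L) +ᵉ (-ᵉ (l +ᵉ R))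

  valid : Bool
  valid = null (reduced (normalize identity))

  size : ℕ
  size = variables identity

toClaim : List Expr → Claim
toClaim (R ∷ L ∷ r ∷ l ∷ _) = claim l r L R
-- A malformed string becomes the harmless claim that 0 ≤ 0 implies 0 ≤ 0.
toClaim _ = claim 0ᵉ 0ᵉ 0ᵉ 0ᵉ

parse : String → Claim
parse s = toClaim (foldl push [] (toList s))

-- Soundness of the normal form in the real field

module Field (ℝ : RealField) where
  open RealField ℝ

  commutativeRing : CommutativeRing 0ℓ 0ℓ
  commutativeRing = record
    { _≈_ = _≡_ ; _+_ = _+_ ; _*_ = _*_ ; -_ = λ x → - x ; 0# = 0r ; 1# = 1r
    ; isCommutativeRing = record
      { isRing = record
        { +-isAbelianGroup = record
          { isGroup = record
            { isMonoid = record
              { isSemigroup = record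
                { isMagma = record { isEquivalence = isEquivalence ; ∙-cong = cong₂ _+_ }
                ; assoc = +-assoc }
              ; identity = comm∧idˡ⇒id +-comm +-identityˡ }
            ; inverse = comm∧invʳ⇒inv +-comm +-inverseʳ
            ; ⁻¹-cong = cong (λ x → - x) }
          ; comm = +-comm }
        ; *-cong = cong₂ _*_
        ; *-assoc = *-assoc
        ; *-identity = comm∧idˡ⇒id *-comm *-identityˡ
        ; distrib = distribˡ , λ x y z → trans (*-comm _ x)
          (trans (distribˡ x y z) (cong₂ _+_ (*-comm x y) (*-comm x z))) }
      ; *-comm = *-comm } }

  open CommutativeRing commutativeRing public using (+-identityʳ; -‿inverseˡ; *-identityʳ; zeroˡ; zeroʳ; distribʳ)
  open import Algebra.Properties.Ring (CommutativeRing.ring commutativeRing) public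
    using (-‿involutive; -0#≈0#; -‿+-comm; -‿distribˡ-*; -‿distribʳ-*; x∙y⁻¹≈ε⇒x≈y)
  open import Algebra.Properties.CommutativeSemigroup
    (CommutativeRing.+-commutativeSemigroup commutativeRing) using (x∙yz≈y∙xz)

  -- With nested pairs, a hidden environment of known length splits into one unknown per atom, and
  -- unification finds each of them.
  Env : ℕ → Set
  Env zero = ⊤
  Env (suc n) = Carrier × Env n

  lookup : ∀ n → Env n → ℕ → Carrier
  -- Indices out of range read as zero; `size` keeps the variables of a claim in range.
  lookup zero ρ i = 0r
  lookup (suc n) ρ zero = proj₁ ρ
  lookup (suc n) ρ (suc i) = lookup n (proj₂ ρ) i

  module Semantics (N : ℕ) (ρ : Env N) where
    ⟦_⟧ : Expr → Carrier
    ⟦ var i ⟧ = lookup N ρ i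
    ⟦ 0ᵉ ⟧ = 0r
    ⟦ 1ᵉ ⟧ = 1r
    ⟦ e +ᵉ f ⟧ = ⟦ e ⟧ + ⟦ f ⟧
    ⟦ e *ᵉ f ⟧ = ⟦ e ⟧ * ⟦ f ⟧
    ⟦ -ᵉ e ⟧ = - ⟦ e ⟧

    ⟦_⟧ₘ : Monomial → Carrier
    ⟦ [] ⟧ₘ = 1r
    ⟦ i ∷ m ⟧ₘ = lookup N ρ i * ⟦ m ⟧ₘ

    signed : Bool → Carrier → Carrier
    signed false x = x
    signed true x = - x

    ⟦_⟧ₚ : Poly → Carrier
    ⟦ [] ⟧ₚ = 0r
    ⟦ (s , m) ∷ p ⟧ₚ = signed s ⟦ m ⟧ₘ + ⟦ p ⟧ₚ

    insert-sound : ∀ i m → ⟦ insert i m ⟧ₘ ≡ lookup N ρ i * ⟦ m ⟧ₘ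
    insert-sound i [] = refl
    insert-sound i (j ∷ m) with i <ᵇ j
    ... | true = refl
    ... | false = trans (cong (lookup N ρ j *_) (insert-sound i m))
      (trans (sym (*-assoc _ _ _)) (trans (cong (_* ⟦ m ⟧ₘ) (*-comm _ _)) (*-assoc _ _ _)))

    mulMono-sound : ∀ m n → ⟦ mulMono m n ⟧ₘ ≡ ⟦ m ⟧ₘ * ⟦ n ⟧ₘ
    mulMono-sound [] n = sym (*-identityˡ _)
    mulMono-sound (i ∷ m) n = trans (insert-sound i (mulMono m n))
      (trans (cong (lookup N ρ i *_) (mulMono-sound m n)) (sym (*-assoc _ _ _)))

    negate-sound : ∀ p → ⟦ negate p ⟧ₚ ≡ - ⟦ p ⟧ₚ
    negate-sound [] = sym -0#≈0#
    negate-sound ((s , m) ∷ p) =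
      trans (cong₂ _+_ (signed-not s) (negate-sound p)) (-‿+-comm _ _)
      where
      signed-not : ∀ s → signed (not s) ⟦ m ⟧ₘ ≡ - signed s ⟦ m ⟧ₘ
      signed-not false = refl
      signed-not true = sym (-‿involutive _)

    signed-* : ∀ s t x y → signed (s xor t) (x * y) ≡ signed s x * signed t y
    signed-* false false x y = refl
    signed-* false true x y = -‿distribʳ-* x y
    signed-* true false x y = -‿distribˡ-* x y
    signed-* true true x y = trans (sym (-‿involutive _))
      (trans (cong -_ (-‿distribʳ-* x y)) (-‿distribˡ-* x (- y)))

    mulTerm-sound : ∀ s m p → ⟦ mulTerm s m p ⟧ₚ ≡ signed s ⟦ m ⟧ₘ * ⟦ p ⟧ₚ
    mulTerm-sound s m [] = sym (zeroʳ _)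
    mulTerm-sound s m ((t , n) ∷ p) = trans
      (cong₂ _+_ (trans (cong (signed (s xor t)) (mulMono-sound m n)) (signed-* s t _ _))
                 (mulTerm-sound s m p))
      (sym (distribˡ _ _ _))

    ++-sound : ∀ p q → ⟦ p ++ q ⟧ₚ ≡ ⟦ p ⟧ₚ + ⟦ q ⟧ₚ
    ++-sound [] q = sym (+-identityˡ _)
    ++-sound (_ ∷ p) q = trans (cong (_ +_) (++-sound p q)) (sym (+-assoc _ _ _))

    mul-sound : ∀ p q → ⟦ mul p q ⟧ₚ ≡ ⟦ p ⟧ₚ * ⟦ q ⟧ₚ
    mul-sound [] q = sym (zeroˡ _)
    mul-sound ((s , m) ∷ p) q = trans (++-sound (mulTerm s m q) (mul p q))
      (trans (cong₂ _+_ (mulTerm-sound s m q) (mul-sound p q)) (sym (distribʳ _ _ _)))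

    normalize-sound : ∀ e → ⟦ normalize e ⟧ₚ ≡ ⟦ e ⟧
    normalize-sound (var i) = trans (+-identityʳ _) (*-identityʳ _)
    normalize-sound 0ᵉ = refl
    normalize-sound 1ᵉ = +-identityʳ _
    normalize-sound (e +ᵉ f) = trans (++-sound (normalize e) (normalize f))
      (cong₂ _+_ (normalize-sound e) (normalize-sound f))
    normalize-sound (e *ᵉ f) = trans (mul-sound (normalize e) (normalize f))
      (cong₂ _*_ (normalize-sound e) (normalize-sound f))
    normalize-sound (-ᵉ e) = trans (negate-sound (normalize e)) (cong -_ (normalize-sound e))

    eqMono-sound : ∀ m n → eqMono m n ≡ true → m ≡ n
    eqMono-sound [] [] _ = refl
    eqMono-sound (i ∷ m) (j ∷ n) eq with i ≡ᵇ j in ij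
    ... | true = cong₂ _∷_ (≡ᵇ-sound i j ij) (eqMono-sound m n eq)
      where
      ≡ᵇ-sound : ∀ i j → (i ≡ᵇ j) ≡ true → i ≡ j
      ≡ᵇ-sound zero zero _ = refl
      ≡ᵇ-sound (suc i) (suc j) eq = cong suc (≡ᵇ-sound i j eq)

    opposite-sound : ∀ s t x → opposite s t ≡ true → signed s x + signed t x ≡ 0r
    opposite-sound true false x _ = -‿inverseˡ x
    opposite-sound false true x _ = +-inverseʳ x

    cancel-sound : ∀ s m p → ⟦ cancel s m p ⟧ₚ ≡ signed s ⟦ m ⟧ₘ + ⟦ p ⟧ₚ
    cancel-sound s m [] = refl
    cancel-sound s m ((t , n) ∷ p) with opposite s t in opp
    ... | false = trans (cong (_ +_) (cancel-sound s m p)) (x∙yz≈y∙xz _ _ _)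
    ... | true with eqMono m n in eq
    ...   | false = trans (cong (_ +_) (cancel-sound s m p)) (x∙yz≈y∙xz _ _ _)
    ...   | true rewrite eqMono-sound m n eq = sym (trans (sym (+-assoc _ _ _))
      (trans (cong (_+ ⟦ p ⟧ₚ) (opposite-sound s t ⟦ n ⟧ₘ opp)) (+-identityˡ _)))

    reduced-sound : ∀ p → ⟦ reduced p ⟧ₚ ≡ ⟦ p ⟧ₚ
    reduced-sound [] = refl
    reduced-sound ((s , m) ∷ p) =
      trans (cancel-sound s m (reduced p)) (cong (_ +_) (reduced-sound p))

    null-sound : ∀ p → null p ≡ true → ⟦ p ⟧ₚ ≡ 0r
    null-sound [] _ = refl

    zero-sound : ∀ e → null (reduced (normalize e)) ≡ true → ⟦ e ⟧ ≡ 0r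
    zero-sound e eq = trans (sym (normalize-sound e))
      (trans (sym (reduced-sound (normalize e))) (null-sound _ eq))

-- Inequalities up to polynomial identities

module OrderedField (ℝ : RealField) where
  open RealField ℝ
  open Field ℝ

  infixl 6 _⊞_
  _⊞_ : ∀ {a b c e} → a ≤ b → c ≤ e → a + c ≤ b + e
  _⊞_ {a} {b} {c} {e} p q = ≤-trans (+-mono-≤ c p)
    (subst₂ _≤_ (+-comm c b) (+-comm e b) (+-mono-≤ b q))

  transfer-≤ : ∀ {l r L R} → L ≤ R → (r + L) - (l + R) ≡ 0r → l ≤ r
  transfer-≤ {l} {r} {L} {R} p eq = subst₂ _≤_ (strip l) (strip r)
    (+-mono-≤ (- L) (subst₂ _≤_ (+-comm L l) (trans (+-comm R l) (sym (x∙y⁻¹≈ε⇒x≈y _ _ eq))) (+-mono-≤ l p)))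
    where
    strip : ∀ u → (u + L) + (- L) ≡ u
    strip u = trans (+-assoc u L (- L)) (trans (cong (u +_) (+-inverseʳ L)) (+-identityʳ u))

  -- The atoms of the claim are found by unification.
  by : (s : String) {ρ : Env (Claim.size (parse s))} {_ : T (Claim.valid (parse s))} →
       let open Claim (parse s); open Semantics _ ρ in ⟦ L ⟧ ≤ ⟦ R ⟧ → ⟦ l ⟧ ≤ ⟦ r ⟧
  by s {ρ} {valid} p =
    transfer-≤ p (Semantics.zero-sound _ ρ (Claim.identity (parse s)) (Equivalence.to T-≡ valid))

  ≤⇒0≤- : ∀ {a b} → a ≤ b → 0r ≤ b - a
  ≤⇒0≤- p = by "0 ab-+ b a" p

  *-monoˡ-≤ : ∀ {k a b} → 0r ≤ k → a ≤ b → k * a ≤ k * b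
  *-monoˡ-≤ {k} {a} {b} k≥0 p = by "ac* ab* 0 abc-+*" (*-nonneg k≥0 (≤⇒0≤- p))

-- Distance on the line, inverses and division

module Reals (ℝ : RealField) where
  open RealField ℝ
  open Field ℝ
  open OrderedField ℝ

  ≡⇒≤ : ∀ {x y} → x ≡ y → x ≤ y
  ≡⇒≤ {x} refl = ≤-refl x

  ∣∣-cases : ∀ x → (0r ≤ x × ∣ x ∣ ≡ x) ⊎ (x ≤ 0r × ∣ x ∣ ≡ - x)
  ∣∣-cases x with 0r ≤? x
  ... | yes 0≤x = inj₁ (0≤x , refl)
  ... | no 0≰x with ≤-total 0r x
  ...   | inj₁ 0≤x = ⊥-elim (0≰x 0≤x)
  ...   | inj₂ x≤0 = inj₂ (x≤0 , refl)

  dist : Carrier → Carrier → Carrier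
  dist x y = ∣ x - y ∣

  abstract
    dist-≤ : ∀ x y {t} → x - y ≤ t → y - x ≤ t → dist x y ≤ t
    dist-≤ x y h₁ h₂ with ∣∣-cases (x - y)
    ... | inj₁ (_ , eq) = ≤-trans (≡⇒≤ eq) h₁
    ... | inj₂ (_ , eq) = ≤-trans (≡⇒≤ eq) (by "cb-+- a bc-+ a" h₂)

    dist-≥ : ∀ x y → x - y ≤ dist x y × y - x ≤ dist x y
    dist-≥ x y with ∣∣-cases (x - y)
    ... | inj₁ (h , eq) = ≡⇒≤ (sym eq) , ≤-trans (by "ba-+ ab-+ 00+ ab-+ab-++"
        (h ⊞ h)) (≡⇒≤ (sym eq))
    ... | inj₂ (h , eq) = ≤-trans (by "ab-+ ab-+- ab-+ab-++ 00+"
        (h ⊞ h)) (≡⇒≤ (sym eq)) , ≤-trans (by "ba-+ ab-+- 0 0" (≤-refl 0r)) (≡⇒≤ (sym eq))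

    dist-nonneg : ∀ x y → 0r ≤ dist x y
    dist-nonneg x y with ∣∣-cases (x - y)
    ... | inj₁ (h , eq) = ≤-trans h (≡⇒≤ (sym eq))
    ... | inj₂ (h , eq) = ≤-trans (by "0 ab-+- ab-+ 0" h) (≡⇒≤ (sym eq))

    dist-refl : ∀ x → dist x x ≤ 0r
    dist-refl x = dist-≤ x x (by "aa-+ 0 0 0" (≤-refl 0r)) (by "aa-+ 0 0 0" (≤-refl 0r))

    dist-sym : ∀ x y → dist x y ≤ dist y x
    dist-sym x y = dist-≤ x y (proj₂ (dist-≥ y x)) (proj₁ (dist-≥ y x))

    dist-tri : ∀ x y z → dist x z ≤ dist x y + dist y z
    dist-tri x y z = dist-≤ x z (chain (proj₁ (dist-≥ x y)) (proj₁ (dist-≥ y z)))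
                                (chain′ (proj₂ (dist-≥ x y)) (proj₂ (dist-≥ y z)))
      where
      chain : ∀ {s t} → x - y ≤ s → y - z ≤ t → x - z ≤ s + t
      chain h₁ h₂ = by "ce-+ ab+ cd-+de-++ ab+" (h₁ ⊞ h₂)
      chain′ : ∀ {s t} → y - x ≤ s → z - y ≤ t → z - x ≤ s + t
      chain′ h₁ h₂ = by "ed-+ ab+ cd-+ec-++ ab+" (h₁ ⊞ h₂)

    dist-separated : ∀ x y → dist x y ≤ 0r → x ≡ y
    dist-separated x y h = ≤-antisym (by "b a ba-+ 0" (≤-trans (proj₁ (dist-≥ x y)) h))
                                     (by "b a ba-+ 0" (≤-trans (proj₂ (dist-≥ x y)) h))

  x²≥0 : ∀ x → 0r ≤ x * x
  x²≥0 x with ≤-total 0r x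
  ... | inj₁ x≥0 = *-nonneg x≥0 x≥0
  ... | inj₂ x≤0 = by "0 aa* 0 0a-+0a-+*" (*-nonneg {0r - x} {0r - x} (by "0 0a-+ a 0"
      x≤0) (by "0 0a-+ a 0" x≤0))

  1≥0 : 0r ≤ 1r
  1≥0 = by "0 1 0 11*" (x²≥0 1r)

  2r : Carrier
  2r = 1r + 1r

  2≢0 : 2r ≢ 0r
  2≢0 eq = 0≢1 (≤-antisym 1≥0 (by "1 0 011++ 10+" (1≥0 ⊞ ≡⇒≤ eq)))

  -- y is the inverse of x; then y = x y², whence y ≥ 0.
  inverse-nonneg : ∀ x y → x * y ≡ 1r → 0r ≤ x → 0r ≤ y
  inverse-nonneg x y eq x≥0 = ≤-trans (*-nonneg x≥0 (x²≥0 y))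
    (≡⇒≤ (trans (sym (*-assoc x y y)) (trans (cong (_* y) eq) (*-identityˡ y))))

  divide : ∀ {x y a b} → x * y ≡ 1r → 0r ≤ y → x * a ≤ b → a ≤ y * b
  divide {x} {y} {a} eq y≥0 h = ≤-trans
    (≡⇒≤ (trans (sym (*-identityˡ a)) (trans (cong (_* a) (trans (sym eq) (*-comm x y))) (*-assoc y x a))))
    (*-monoˡ-≤ y≥0 h)

  1≤1+ : ∀ {r} → 0r ≤ r → 1r ≤ 1r + r
  1≤1+ r≥0 = by "1 1a+ 0 a" r≥0

  -- The summand 1 makes the factor at least one and only adds `x ≥ 0`; the additive constant is
  -- zero.
  regroup : ∀ {l e k T x c} → 0r ≤ x → c ≤ l * (e * (k * (k * (T * x)))) →
    c ≤ (1r + l * (e * (k * (k * T)))) * x + 0r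
  regroup x≥0 c≤ = by "f 1abccd****+e*0+ 0f+ eabccde*****+" (x≥0 ⊞ c≤)

module Analysis (ℝ : RealField) where

  open RealField ℝ
  open Field ℝ
  open OrderedField ℝ
  open Reals ℝ

  -- The potential: slacks of the work function with slope 1 - κ

  module Potential
    (κ η : Carrier) (κ≥0 : 0r ≤ κ) (η≥0 : 0r ≤ η)
    (κ+κ≤1 : κ + κ ≤ 1r) (4η≤κ : η + η + (η + η) ≤ κ)
    -- The distance of coordinates enters through these laws only, all of them inequalities that can
    -- be added up.
    (δ : Carrier → Carrier → Carrier)
    (δ≥0 : ∀ x y → 0r ≤ δ x y)
    (δ-refl : ∀ x → δ x x ≤ 0r)
    (δ-sym : ∀ x y → δ x y ≤ δ y x)
    (δ-tri : ∀ x y z → δ x z ≤ δ x y + δ y z)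
    where

    Fun : Set
    Fun = Carrier → Carrier → Carrier

    -- The slope 1 - κ lies strictly between λ ≤ 1 - 2κ and 1.
    μ : Carrier → Carrier
    μ t = t - κ * t

    κ≤1 : κ ≤ 1r
    κ≤1 = by "a 1 aa+0+ 1a+" (κ+κ≤1 ⊞ κ≥0)

    infixr 8 κ*_ μ*_
    κ*_ : ∀ {a b} → a ≤ b → κ * a ≤ κ * b
    κ*_ = *-monoˡ-≤ κ≥0

    μ*_ : ∀ {a b} → a ≤ b → μ a ≤ μ b
    μ*_ p = by "cbc*-+ aba*-+ 1b-+c* 1b-+a*" (*-monoˡ-≤ (≤⇒0≤- κ≤1) p)

    δ-tri₄ : ∀ x y z w → δ x w ≤ δ x y + δ y z + δ z w
    δ-tri₄ x y z w = by "d ab+c+ de+ ae+bc++" (δ-tri x y w ⊞ δ-tri y z w)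

    maximum₃ : ∀ a b c → ∃ λ m → a ≤ m × b ≤ m × c ≤ m × (m ≤ a ⊎ m ≤ b ⊎ m ≤ c)
    maximum₃ a b c with ≤-total a b | ≤-total a c | ≤-total b c
    ... | inj₁ a≤b | _ | inj₁ b≤c = c , ≤-trans a≤b b≤c , b≤c , ≤-refl c , inj₂ (inj₂ (≤-refl c))
    ... | inj₁ a≤b | _ | inj₂ c≤b = b , a≤b , ≤-refl b , c≤b , inj₂ (inj₁ (≤-refl b))
    ... | inj₂ b≤a | inj₁ a≤c | _ = c , a≤c , ≤-trans b≤a a≤c , ≤-refl c , inj₂ (inj₂ (≤-refl c))
    ... | inj₂ b≤a | inj₂ c≤a | _ = a , ≤-refl a , b≤a , c≤a , inj₁ (≤-refl a)

    Lipschitz : Fun → Set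
    Lipschitz W = ∀ x y x′ y′ → W x y ≤ W x′ y′ + (δ x x′ + δ y y′)

    -- The mark of a work function whose last request is `(a , b)`: an optimal path to any point
    -- leaves this request at some `(a , v)` or `(u , b)`.
    Supported : Carrier → Carrier → Fun → Set
    Supported a b W = ∀ x y →
      (∃ λ v → W a v + (δ a x + δ v y) ≤ W x y) ⊎
      (∃ λ u → W u b + (δ u x + δ b y) ≤ W x y)

    -- What is known of the passage from a work function to the next one. Together with `mono`, the
    -- values on both lines of the request stay the same.
    record Update (a b : Carrier) (W W′ : Fun) : Set where
      field
        lip : Lipschitz W
        lip′ : Lipschitz W′
        mono : ∀ x y → W x y ≤ W′ x y
        onV : ∀ y → W′ a y ≤ W a y
        onH : ∀ x → W′ x b ≤ W x b
        supp′ : Supported a b W′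

    -- With w = W p, the number m bounds the slacks w + μ d(p,z) - W z for z on the line V
    -- through p, and e bounds inf_{u ∈ V} (W u + μ d(u,z)) - W z for all z.
    record Half (px py : Carrier) (W : Fun) (m e : Carrier) : Set where
      field
        M : ∀ y → W px py + μ (δ py y) ≤ m + W px y
        E : ∀ x y → ∃ λ v → W px v + μ (δ px x + δ v y) ≤ e + W x y
        e≥0 : 0r ≤ e

    open Half

    -- The bound `M` is applied to `p` itself.
    m≥0 : ∀ {px py W m e} → Half px py W m e → 0r ≤ m
    m≥0 {px} {py} h = by "0 a bcdc*-++0d0*-++ ab+cdc*-++" (M h py ⊞ μ* δ≥0 py py)

    slack : Carrier → Carrier → Fun → Fun
    slack px py W x y = W px py + μ (δ px x + δ py y) - W x y

    -- The alternatives compare the second point with p and with the first point.  When the first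
    -- point is replaced by one at distance L from which its value came, the second alternative
    -- loses at most 2 κ L, whereas the weight 3 makes the slack of the first point gain 3 κ L.
    PairBound : Carrier → Carrier → Fun → Carrier → (x₁ y₁ x₂ y₂ : Carrier) → Set
    PairBound px py W q x₁ y₁ x₂ y₂ =
      (S x₁ y₁ + S x₁ y₁ + S x₁ y₁ + κ * S x₂ y₂ ≤ q) ⊎
      (S x₁ y₁ + S x₁ y₁ + S x₁ y₁ + κ * (W x₁ y₁ + μ (δ x₁ x₂ + δ y₁ y₂) - W x₂ y₂) ≤ q)
      where S = slack px py W

    Pair : Carrier → Carrier → Fun → Carrier → Set
    Pair px py W q = ∀ x₁ y₁ x₂ y₂ → PairBound px py W q x₁ y₁ x₂ y₂

    -- This is `W s ≤ W z + (1 - 2κ) d(z, s)` without subtraction. Its slope is smaller by κ than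
    -- the slope of the slacks.
    Reachable : Fun → Carrier → Carrier → Set
    Reachable W sx sy = ∀ x y →
      W sx sy + κ * (δ x sx + δ y sy) + κ * (δ x sx + δ y sy) ≤ W x y + (δ x sx + δ y sy)

    -- A request that contains the line V

    module Step {px py b : Carrier} {W W′ : Fun} (upd : Update px b W W′) where
      open Update upd

      β = δ b py

      -- The values on V stay, and all others can only rise.
      half-mono : ∀ {m e} → Half px py W m e → Half px py W′ m e
      half-mono h .M y = by "fded*-++ ab+ cded*-++f+g+ ag+c+b+" (M h y ⊞ onV py ⊞ mono px y)
      half-mono h .E x y with E h x y
      ... | v , h₁ = v , by "gde+fde+*-++ ab+ cde+fde+*-++g+h+ ah+c+b+" (h₁ ⊞ onV v ⊞ mono x y)
      half-mono h .e≥0 = e≥0 h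

      slack-anti : ∀ x y → slack px py W′ x y ≤ slack px py W x y
      slack-anti x y = by "fbc+dbc+*-++g-+ abc+dbc+*-++e-+ fe+ ag+" (onV py ⊞ mono x y)

      pair-mono : ∀ {q} → Pair px py W q → Pair px py W′ q
      pair-mono h x₁ y₁ x₂ y₂ with h x₁ y₁ x₂ y₂
      ... | inj₁ g = inj₁ (by "jcd+ecd+*-++k-+jcd+ecd+*-++k-++jcd+ecd+*-++k-++ejgh+egh+*-++l-+*+ a bcd+ecd+*-++f-+bcd+ecd+*-++f-++bcd+ecd+*-++f-++ebgh+egh+*-++i-+*+jcd+ecd+*-++k-++jcd+ecd+*-++k-++jcd+ecd+*-++k-++ejgh+egh+*-++l-+*+ abcd+ecd+*-++f-++bcd+ecd+*-++f-++bcd+ecd+*-++f-++ebgh+egh+*-++i-+*+"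
          (g ⊞ slack-anti x₁ y₁ ⊞ slack-anti x₁ y₁ ⊞ slack-anti x₁ y₁
                                ⊞ κ* slack-anti x₂ y₂))
      -- The value at the first point has the total coefficient κ - 3, so its rise only helps.
      ... | inj₂ g = inj₂ (by "jcd+ecd+*-++k-+jcd+ecd+*-++k-++jcd+ecd+*-++k-++ekgh+egh+*-++l-+*+ a bcd+ecd+*-++f-+bcd+ecd+*-++f-++bcd+ecd+*-++f-++efgh+egh+*-++i-+*+j+j+j+f+f+fef*-++ei*+ ab+b+b+k+k+kek*-++el*+"
          (g ⊞ onV py ⊞ onV py ⊞ onV py ⊞ mono x₁ y₁ ⊞ mono x₁ y₁ ⊞ μ* mono x₁ y₁
                                ⊞ κ* mono x₂ y₂))

      -- Off V the new function is reached from the line y = b₀, at the extra cost d(b₀, b).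
      payV : ∀ {b₀ m e P} → Supported px b₀ W → 0r ≤ e - P → P ≤ κ * δ b₀ b →
             Half px py W m e → Half px py W′ m (e - P)
      payV supp P≤e P≤ h .M = half-mono h .M
      payV supp P≤e P≤ h .e≥0 = P≤e
      payV {b₀} supp P≤e P≤ h .E x y with supp′ x y
      ... | inj₁ (v , h₁) = v , by "def+gef+*-++ ab-+c+ def++0+g00+*+ cab-++gef+*+"
          (h₁ ⊞ P≤e ⊞ κ* (δ≥0 px x ⊞ δ≥0 v y))
      ... | inj₂ (u , h₁) with supp u b
      ...   | inj₁ (v , h₂) = v ,
          by "klm+nlm+*-++ ab-+c+ def++g+hij+++k+l+m+0+n00+*+ cd+g+h+ie++jf++ab-++nlm+*+"
          (h₁ ⊞ mono u b ⊞ h₂ ⊞ onV v ⊞ δ-tri px u x ⊞ δ-tri v b y ⊞ P≤e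
                                      ⊞ κ* (δ≥0 px x ⊞ δ≥0 v y))
      -- The way from `b₀` to `b` is paid in full by `W′`, but counts with slope 1 - κ in `E`; the
      -- rest is `κ * δ b₀ b`.
      ...   | inj₂ (t , h₂) with E h t b₀
      ...     | v , h₃ = v , by "opq+npq+*-++ ab-+c+ def++g+hij+++klm+nlm+*-+++o+pq+npq+*-++n00+0+*+b+ cd+g+ah++k+li+e+mj+f++nli+e+mj+f++*-++nie+f+*+nj*+"
          (h₁ ⊞ mono u b ⊞ h₂ ⊞ h₃ ⊞ onV v
                                 ⊞ μ* (δ-tri₄ px t u x ⊞ δ-tri₄ v b₀ b y)
                                 ⊞ κ* (δ≥0 t u ⊞ δ≥0 u x ⊞ δ≥0 b y) ⊞ P≤)

      -- From the given point to H with loss `e`, then along H to `p` with loss `m`.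
      E-from-p : ∀ {m e} → Half py px (flip W) m e →
                 ∀ x y → W′ px py + μ (δ py y + δ px x) ≤ m + e + W′ x y
      E-from-p h x y with E h y x
      ... | u , h₁ = by "jel+gel+*-++ ab+c+ def+gef+*-++higi*-+++j+k+lgl*-++ bk+ad++h+c+if+gif+*-++"
          (h₁ ⊞ M h u ⊞ onV py ⊞ mono x y ⊞ μ* δ-tri px u x)

      -- A path to H can go on to the line `y = b`, at distance β, and return.
      rise : ∀ u → W′ u py ≤ W u py + (β + β)
      rise u = by "c abb++ cd+e+f+f+g+ dfg++e+afb+++0+0+b+"
          (lip′ u py u b ⊞ onH u ⊞ lip u b u py ⊞ δ-refl u ⊞ δ-refl u ⊞ δ-sym py b)

      -- The previous request contains V as well

      module AfterV {b₀} (supp : Supported px b₀ W) where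

        -- The extra length of the way from `y = b₀` to H when it has to touch `y = b`.
        θ = β - δ b₀ py + δ b₀ b

        θ≥0 : 0r ≤ θ
        θ≥0 = by "0 ab-+c+ b ca+" (δ-tri b₀ b py)

        -- A path that has last been on V is no better than one through `p`. Any other goes from
        -- `y = b₀` over `y = b` to H, and is longer by θ than the way that `M` accounts for.
        slackH : ∀ {m e} → Half py px (flip W) m e → ∀ x →
                 (W′ px py + δ px x ≤ W′ x py) ⊎ (W′ px py + μ (δ px x) + θ ≤ m + W′ x py)
        slackH h x with supp′ x py
        ... | inj₁ (v , h₁) = inj₁ (by "ec+ a bcd++e+f+g+ abfg+++0+d+"
            (h₁ ⊞ lip′ px py px v ⊞ δ-refl px ⊞ δ-sym py v))
        ... | inj₂ (u , h₁) with supp u b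
        ...   | inj₁ (v , h₂) = inj₁ (
            by "in+ a bcd++e+fgh+++i+j+k+l+m+n+ ab+e+j+fkl+++0+m+hd++gc++"
            (h₁ ⊞ mono u b ⊞ h₂ ⊞ onV py ⊞ lip px py px v ⊞ δ-refl px
                                          ⊞ δ-sym py v ⊞ δ-tri v b py ⊞ δ-tri px u x))
        ...   | inj₂ (t , h₂) = inj₂ (
            by "jqmq*-++er-+i++ ab+ cde++f+ghi+++j+klml*-+++n+o+p+qmq*-++m00+*+ bc+f+k+an++gop+++0+r+lh+d+mlh+d+*-++mhd+*+"
            (h₁ ⊞ mono u b ⊞ h₂ ⊞ onV py ⊞ M h t ⊞ lip t py t b₀ ⊞ δ-refl t
                                          ⊞ δ-sym py b₀ ⊞ μ* δ-tri₄ px t u x ⊞ κ* (δ≥0 t u ⊞ δ≥0 u x)))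

        -- An old path from `y = b₀` is bent so as to touch `y = b`; one from V needs no change.
        riseθ : ∀ u → W′ u py ≤ W u py + θ
        riseθ u with supp u py
        ... | inj₁ (v , h₁) = by "h abc-+d++ efg++h+i+j+k+0+ aijk+++e+f+g+bc-+d++"
            (h₁ ⊞ lip′ u py px v ⊞ onV v ⊞ δ-sym u px ⊞ δ-sym py v ⊞ θ≥0)
        ... | inj₂ (t , h₁) = by "g abc-+d++ efc++g+h+i+j+k+l+m+ ahjk+++i+elm+++0+b+f+d+"
            (h₁ ⊞ lip′ u py u b ⊞ onH u ⊞ lip u b t b₀ ⊞ δ-refl u ⊞ δ-sym py b
                                  ⊞ δ-sym u t ⊞ δ-sym b b₀)

        -- E may grow because the values on H rise, but never by more than M falls.
        stepH : ∀ {m e} → Half py px (flip W) m e →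
                ∃ λ m′ → ∃ λ e′ → (m′ + e′ ≤ m + e) × Half py px (flip W′) m′ e′
        stepH {m} {e} h with ≤-total θ m
        ... | inj₁ θ≤m = m - θ , e + θ , by "acd-+e+-+bcd-+e+++ ab+ 0 0" (≤-refl 0r) , record
          { M = slack-bound
          ; E = λ y x → let u , h₁ = E h y x in u ,
              by "jgh+igh+*-++ abc-+d++e+ fgh+igh+*-++j+k+ ak+fbc-+d+++e+" (h₁ ⊞ riseθ u ⊞ mono x y)
          ; e≥0 = by "0 abc-+d++ 00+ abc-+d++" (e≥0 h ⊞ θ≥0) }
          where
          slack-bound : ∀ x → W′ px py + μ (δ px x) ≤ m - θ + W′ x py
          slack-bound x with slackH h x
          ... | inj₁ h₁ = by "fghg*-++ abc-+d+-+e+ fg+bc-+d++h0*+ ea+hg*+" (h₁ ⊞ θ≤m ⊞ κ* δ≥0 px x)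
          ... | inj₂ h₁ = by "fghg*-++ abc-+d+-+e+ fghg*-++bc-+d++ ae+" h₁
        -- Once `M` has fallen to zero, `p` alone realises `E` for all points, with the bound
        -- `m + e`.
        ... | inj₂ m≤θ = 0r , m + e , by "0ab++ ab+ 0 0" (≤-refl 0r) , record
          { M = slack-bound
          ; E = λ y x → px , E-from-p h x y
          ; e≥0 = by "0 ab+ 00+ ba+" (e≥0 h ⊞ m≥0 h) }
          where
          slack-bound : ∀ x → W′ px py + μ (δ px x) ≤ 0r + W′ x py
          slack-bound x with slackH h x
          ... | inj₁ h₁ = by "bcdc*-++ 0a+ bc+d0*+ adc*+" (h₁ ⊞ κ* δ≥0 px x)
          ... | inj₂ h₁ = by "bcdc*-++ 0a+ bcdc*-++ef-+g++h+ ha+ef-+g++" (h₁ ⊞ m≤θ)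

      -- The previous request contains H

      module AfterH {a} (supp : Supported a py W) where

        α = δ a px

        -- A value of W′ either results from a detour of length at least ξ, or is no better than
        -- those at p or at the corner (a, b), the only points in which the two requests meet.
        data Rising (ξ : Carrier) (x y : Carrier) : Set where
          far : ∀ u v L → ξ ≤ L → δ u x + δ v y ≤ L → W u v + L ≤ W′ x y → Rising ξ x y
          dead : W px py + (δ px x + δ py y) ≤ W′ x y → Rising ξ x y
          corner : W a b + (δ a x + δ b y) ≤ W′ x y → Rising ξ x y

        -- As before, but a path that ends on H after `y = b` either came from H, which makes a
        -- detour of β + β, or came from the column `x = a` and is no better than one through the
        -- corner.
        slackH : ∀ {m e} → Half py px (flip W) m e → ∀ x →
                 (W′ px py + δ px x ≤ W′ x py) ⊎
                 (W′ px py + μ (δ px x) + (β + β) ≤ m + W′ x py) ⊎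
                 (W a b + δ a x + β ≤ W′ x py)
        slackH h x with supp′ x py
        ... | inj₁ (v , h₁) = inj₁ (by "ec+ a bcd++e+f+g+ abfg+++0+d+"
            (h₁ ⊞ lip′ px py px v ⊞ δ-refl px ⊞ δ-sym py v))
        ... | inj₂ (u , h₁) with supp u b
        ...   | inj₁ (v , h₂) = inj₂ (inj₂ (by "il+d+ a bcd++e+fgh+++i+j+k+l+ ab+e+fjk+++0+h+gc++"
            (h₁ ⊞ mono u b ⊞ h₂ ⊞ lip a b a v ⊞ δ-refl a ⊞ δ-sym b v
                                                ⊞ δ-tri a u x)))
        ...   | inj₂ (t , h₂) = inj₂ (inj₁ (
            by "jnmn*-++ee++ ab+ cde++f+ghi+++j+klml*-+++e+nmn*-++m00+*+ bc+f+k+ag++i+lh+d+mlh+d+*-++mhd+*+"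
            (h₁ ⊞ mono u b ⊞ h₂ ⊞ onV py ⊞ M h t ⊞ δ-sym b py
                                                ⊞ μ* δ-tri₄ px t u x ⊞ κ* (δ≥0 t u ⊞ δ≥0 u x))))

        -- Tracing a path back through the last two requests: a change between parallel lines costs
        -- α or β, and a change of direction leads through `p` or the corner.
        rising : ∀ {ξ} → ξ ≤ α → ξ ≤ β → ∀ x y → Rising ξ x y
        rising ξ≤α ξ≤β x y with supp′ x y
        rising ξ≤α ξ≤β x y | inj₁ (v , h₁) with supp px v
        ... | inj₁ (w , h₂) = far a w (α + δ w v + δ px x + δ v y)
          (by "e ab+c+d+ e0+0+0+ ab+c+d+"
              (ξ≤α ⊞ δ≥0 w v ⊞ δ≥0 px x ⊞ δ≥0 v y)) (by "ef+ ab+c+d+ ef+ ac+bd++"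
              (δ-tri a px x ⊞ δ-tri w v y))
          (by "fgh+c+d++ a bcd++e+fgh+++ ab+e+" (h₁ ⊞ mono px v ⊞ h₂))
        ... | inj₂ (t , h₂) = dead (by "icl++ a bcd++e+fgh+++i+j+k+l+ ab+e+fkj+++0+g+hd++"
            (h₁ ⊞ mono px v ⊞ h₂ ⊞ lip px py t py ⊞ δ-refl py ⊞ δ-sym px t
          ⊞ δ-tri py v y))
        rising ξ≤α ξ≤β x y | inj₂ (u , h₁) with supp u b
        ... | inj₁ (v , h₂) = corner (by "ild++ a bcd++e+fgh+++i+j+k+l+ ab+e+fjk+++0+h+gc++"
            (h₁ ⊞ mono u b ⊞ h₂ ⊞ lip a b a v ⊞ δ-refl a ⊞ δ-sym b v
          ⊞ δ-tri a u x))
        ... | inj₂ (t , h₂) = far t py (δ t u + δ py b + δ u x + δ b y)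
          (by "e ab+c+d+ ef+0+0+0+ fb+a+c+d+" (ξ≤β ⊞ δ-sym b py ⊞ δ≥0 t u ⊞ δ≥0 u x ⊞ δ≥0 b y))
          (by "ef+ ab+c+d+ ef+ ac+bd++"
              (δ-tri t u x ⊞ δ-tri py b y)) (by "fgh+c+d++ a bcd++e+fgh+++ ab+e+"
              (h₁ ⊞ mono u b ⊞ h₂))

        -- `E` leads from the corner to H, and `M` along H to `p`.
        corner-slack : ∀ {m e} → Half py px (flip W) m e →
                       W px py + μ (δ px a) + μ β ≤ m + e + W a b
        corner-slack h with E h b a
        ... | u , h₁ = by "hjgj*-++kgk*-++ ab+c+ def+gef+*-++higi*-+++jk+gjk+*-++ bc+ad++if+e+gif+e+*-++"
            (h₁ ⊞ M h u ⊞ μ* (δ-tri px u a ⊞ δ-sym b py))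

        column-slack : ∀ {m e} → Half py px (flip W) m e → ∀ v →
                       W px py + μ (δ px a) + μ (δ py v) ≤ m + e + W a v
        column-slack h v with E h v a
        ... | u , h₁ = by "hjgj*-++ege*-++ ab+c+ def+gef+*-++higi*-+++jgj*-++ bc+ad++if+gif+*-++"
            (h₁ ⊞ M h u ⊞ μ* δ-tri px u a)

        corner-E≥0 : ∀ {m e m′} → Half py px (flip W) m e →
          m′ + W a b + β ≤ W px py + μ (δ px a) → 0r ≤ m + e - m′
        corner-E≥0 h m′≤ = by "0 ab+c-+ defe*-++gfg*-++ch+g++0+0f0*-++ ab+h+defe*-+++g+gfg*-++"
            (corner-slack h ⊞ m′≤ ⊞ δ≥0 b py ⊞ μ* δ≥0 b py)

        -- By `corner-slack` the new bound is at least β + μ β, which pays for crossing from `y = b`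
        -- to H. Points reached from the column `x = a` are compared with `(a , py)`, whose value is
        -- at most β above that of the corner.
        E-from-corner : ∀ {m e m′} → Half py px (flip W) m e →
          m′ + W a b + β ≤ W px py + μ (δ px a) →
          ∀ x y → ∃ λ u → W′ u py + μ (δ py y + δ u x) ≤ m + e - m′ + W′ x y
        E-from-corner h m′≤ x y with supp′ x y
        ... | inj₂ (u , h₁) = u ,
            by "hjf+kjf+*-++ ab+c-+d+ efg++h+i+jkj*-++l+lkl*-++mnkn*-++oko*-+++cp+o++k00+*+ deil+++0+lg+klg+*-++o+oko*-++ab+p++mnkn*-+++kfg+*+"
            (h₁ ⊞ lip′ u py u b ⊞ δ-refl u ⊞ μ* δ-tri py b y ⊞ δ-sym py b
          ⊞ μ* δ-sym py b ⊞ corner-slack h ⊞ m′≤ ⊞ κ* (δ≥0 u x ⊞ δ≥0 b y))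
        ... | inj₁ (v , h₁) with supp px v
        ...   | inj₁ (w , h₂) = a ,
            by "pvw+nvw+*-++ ab+c-+d+ efg++h+ijk+++lmnm*-++ono*-+++p+q+r+s+ct+u++vw+nvw+*-++n00+0+0+*+ de+h+ab+i++qrs+++t+0+u+lmnm*-+++ok+g+jf++nok+g+jf++*-++njk+g+f+*+"
            (h₁ ⊞ mono px v ⊞ h₂ ⊞ column-slack h w ⊞ lip′ a py a b ⊞ onH a
          ⊞ δ-refl a ⊞ δ-sym py b ⊞ m′≤ ⊞ μ* (δ-tri₄ py w v y ⊞ δ-tri a px x)
          ⊞ κ* (δ≥0 a px ⊞ δ≥0 w v ⊞ δ≥0 v y ⊞ δ≥0 px x))
        ...   | inj₂ (t , h₂) = px ,
            by "lpf+qpf+*-++ ab+c-+d+ efg++h+ijk+++l+m+n+o+pqp*-++0+q00+0+*+ de+h+m+ion+++0+j+kg+qkg+*-++ab+c-++qgk+f+*+"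
            (h₁ ⊞ mono px v ⊞ h₂ ⊞ onV py ⊞ lip px py t py ⊞ δ-refl py ⊞ δ-sym px t
          ⊞ μ* δ-tri py v y ⊞ corner-E≥0 h m′≤ ⊞ κ* (δ≥0 v y ⊞ δ≥0 py v ⊞ δ≥0 px x))

        stepH : ∀ {m e} → Half py px (flip W) m e →
                ∃ λ m′ → ∃ λ e′ → (m′ + e′ ≤ m + e) × Half py px (flip W′) m′ e′
        stepH {m} {e} h
          -- The candidates are the bounds that the three cases of `slackH` give on H. `E` gains
          -- what `M` loses, and the largest candidate decides which point of H realises `E`.
          with maximum₃ 0r (m - (β + β)) (W px py + μ (δ px a) - W a b - β)
        ... | m′ , m′≥0 , m′≥₂ , m′≥₃ , which = m′ , m + e - m′ , by "cab+c-++ ab+ 0 0"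
            (≤-refl 0r) , record
          { M = slack-bound ; E = λ y x → E′ which x y ; e≥0 = e′≥0 which }
          where
          slack-bound : ∀ x → W′ px py + μ (δ px x) ≤ m′ + W′ x py
          slack-bound x with slackH h x
          ... | inj₁ h₁ = by "cded*-++ ab+ cd+0+e0*+ ba+ed*+" (h₁ ⊞ m′≥0 ⊞ κ* δ≥0 px x)
          ... | inj₂ (inj₁ h₁) = by "cded*-++ ab+ cded*-++ff++gff+-++ gb+a+" (h₁ ⊞ m′≥₂)
          ... | inj₂ (inj₂ h₁) =
              by "ijhj*-++ ab+ cd+e+fghg*-++c-+e-++i+jhj*-++h0*+ ba+f+gd+hgd+*-++hd*+"
              (h₁ ⊞ m′≥₃ ⊞ onV py ⊞ μ* δ-tri px a x ⊞ κ* δ≥0 a x)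
          Choice = (m′ ≤ 0r) ⊎ (m′ ≤ m - (β + β)) ⊎ (m′ ≤ W px py + μ (δ px a) - W a b - β)
          E′ : Choice → ∀ x y → ∃ λ u → W′ u py + μ (δ py y + δ u x) ≤ m + e - m′ + W′ x y
          E′ (inj₁ m′≤) x y = px , by "efg+hfg+*-++ ab+c-+d+ efg+hfg+*-++c+ ab+d+0+"
              (E-from-p h x y ⊞ m′≤)
          E′ (inj₂ (inj₁ m′≤)) x y with E h y x
          ... | u , h₁ = u , by "ifg+hfg+*-++ ab+c-+d+ efg+hfg+*-++i+j+c+ bj+ekk+++d+akk+-++"
              (h₁ ⊞ rise u ⊞ mono x y ⊞ m′≤)
          E′ (inj₂ (inj₂ m′≤)) x y = E-from-corner h (by "de+f+ abcb*-++ d abcb*-++e-+f-+" m′≤) x y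
          e′≥0 : Choice → 0r ≤ m + e - m′
          e′≥0 (inj₁ m′≤) = by "0 ab+c-+ 00+c+ ab+0+" (m≥0 h ⊞ e≥0 h ⊞ m′≤)
          e′≥0 (inj₂ (inj₁ m′≤)) = by "0 ab+c-+ 0c+0+0+ badd+-++d+d+"
              (e≥0 h ⊞ m′≤ ⊞ δ≥0 b py ⊞ δ≥0 b py)
          e′≥0 (inj₂ (inj₂ m′≤)) = corner-E≥0 h (by "de+f+ abcb*-++ d abcb*-++e-+f-+" m′≤)

        -- For `a` close to V: paths from the column `x = a` are moved to V at the cost α + α, while
        -- those from H to `y = b` make a detour of β, worth `κ * β`.
        payV-far : ∀ {m e P} → 0r ≤ e - P → P ≤ κ * β → α + α ≤ e - P →
                   Half px py W m e → Half px py W′ m (e - P)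
        payV-far P≤e P≤ α≤ h .M = half-mono h .M
        payV-far P≤e P≤ α≤ h .e≥0 = P≤e
        payV-far P≤e P≤ α≤ h .E x y with supp′ x y
        ... | inj₁ (v , h₁) = v , by "def+gef+*-++ ab-+c+ def++0+g00+*+ cab-++gef+*+"
            (h₁ ⊞ P≤e ⊞ κ* (δ≥0 px x ⊞ δ≥0 v y))
        ... | inj₂ (u , h₁) with supp u b
        ...   | inj₁ (v , h₂) = v ,
            by "kpq+rpq+*-++ ab-+c+ def++g+hij+++k+l+m+n+oo++pq+n+rpq+n+*-++r00+0+0+0+*+ cd+g+l+hnm+++0+o+ab-++ni+e+jf++o+rni+e+jf++o+*-++roi+e+j+f+*+"
            (h₁ ⊞ mono u b ⊞ h₂ ⊞ onV v ⊞ lip px v a v ⊞ δ-refl v ⊞ δ-sym px a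
          ⊞ α≤ ⊞ μ* (δ-tri₄ px a u x ⊞ δ-tri v b y ⊞ δ-sym px a)
          ⊞ κ* (δ≥0 a px ⊞ δ≥0 a u ⊞ δ≥0 u x ⊞ δ≥0 v b ⊞ δ≥0 b y))
        ...   | inj₂ (t , h₂) with E h t py
        ...     | v , h₃ = v ,
            by "oqr+nqr+*-++ ab-+c+ def++g+hij+++klm+nlm+*-+++o+b+np*+qr+nqr+*-++n00+0+*+ cd+g+ah++k+np*+nj*+li+e+mj+f++nli+e+mj+f++*-++nie+f+*+"
            (h₁ ⊞ mono u b ⊞ h₂ ⊞ h₃ ⊞ onV v ⊞ P≤ ⊞ κ* δ-sym b py
          ⊞ μ* (δ-tri₄ px t u x ⊞ δ-tri₄ v py b y) ⊞ κ* (δ≥0 t u ⊞ δ≥0 u x ⊞ δ≥0 b y))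

        -- For `b` close to H: points reached from `y = b` are moved to H at the cost β + β, while
        -- paths from `x = a` to V make a detour of α. The worth `κ * α` of the detour must also
        -- cover the rise β + β on H.
        payH : ∀ {m e P} → 0r ≤ e - P → P + (β + β) ≤ κ * α → β + β ≤ e - P →
               Half py px (flip W) m e → Half py px (flip W′) m (e - P)
        payH P≤e P≤ β≤ h .M x = by "fded*-++ ab+ cded*-++f+g+ ag+c+b+" (M h x ⊞ onV py ⊞ mono x py)
        payH P≤e P≤ β≤ h .e≥0 = P≤e
        payH P≤e P≤ β≤ h .E y x with supp′ x y
        ... | inj₂ (u , h₁) = u ,
            by "gie+jie+*-++ ab-+c+ def++g+h+iji*-++k+kjk*-++ll++j00+0+*+ cdhk+++0+kf+jkf+*-++l+ljl*-++ab-++jef+l+*+"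
            (h₁ ⊞ lip′ u py u b ⊞ δ-refl u ⊞ μ* δ-tri py b y ⊞ δ-sym py b
          ⊞ μ* δ-sym py b ⊞ β≤ ⊞ κ* (δ≥0 u x ⊞ δ≥0 b y ⊞ δ≥0 b py))
        ... | inj₁ (v , h₁) with supp px v
        ...   | inj₁ (w , h₂) with E h w a
        ...     | u , h₃ = u ,
            by "oqr+nqr+*-++ ab-+c+ def++g+hij+++klm+nlm+*-+++o+bpp+++qr+nqr+*-++n00+0+*+ cd+g+ah++kpp+++ni*+lj+f+mi+e++nlj+f+mi+e++*-++njf+e+*+"
            (h₁ ⊞ mono px v ⊞ h₂ ⊞ h₃ ⊞ rise u ⊞ P≤
          ⊞ μ* (δ-tri₄ py w v y ⊞ δ-tri₄ u a px x)
          ⊞ κ* (δ≥0 w v ⊞ δ≥0 v y ⊞ δ≥0 px x))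
        payH P≤e P≤ β≤ h .E y x | inj₁ (v , h₁) | inj₂ (t , h₂) =
          px , by "koe+poe+*-++ ab-+c+ def++g+hij+++k+l+m+n+opo*-++0+p00+0+*+ cd+g+l+hnm+++0+i+jf+pjf+*-++ab-++pfj+e+*+"
              (h₁ ⊞ mono px v ⊞ h₂ ⊞ onV py ⊞ lip px py t py ⊞ δ-refl py ⊞ δ-sym px t
          ⊞ μ* δ-tri py v y ⊞ P≤e ⊞ κ* (δ≥0 v y ⊞ δ≥0 py v ⊞ δ≥0 px x))

        -- The pair bound pays

        module PayPair {ξ P sx sy : Carrier} (ξ≥0 : 0r ≤ ξ) (P≤ : P ≤ κ * (κ * ξ))
          (ξ≤α : ξ ≤ α) (ξ≤β : ξ ≤ β)
          (ξ≤ps : ξ ≤ δ px sx + δ py sy) (ξ≤os : ξ ≤ δ a sx + δ b sy)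
          (reach : Reachable W sx sy) where

          P≤κξ : P ≤ κ * ξ
          P≤κξ = by "c ab* c0a0*-++ aab**ab*aab**-++" (P≤ ⊞ μ* *-nonneg κ≥0 ξ≥0)

          -- Both points are taken to be `s`, whose slack is at least `κ * ξ` by `reach`.
          P≤q : ∀ {q} → Pair px py W q → P ≤ q
          P≤q h with h sx sy sx sy
          ... | inj₁ g = by "g a bcd+ecd+*-++f-+bcd+ecd+*-++f-++bcd+ecd+*-++f-++ebcd+ecd+*-++f-+*+fecd+*+ecd+*++fecd+*+ecd+*++fecd+*+ecd+*++efecd+*+ecd+*+*+g+eh*+e00+*+e00+*+ee00+**+ abcd+++bcd+++bcd+++ebcd++*+eh*+ecd+*+ecd+*+ecd+*+eecd+**+"
              (g ⊞ reach px py ⊞ reach px py ⊞ reach px py ⊞ κ* reach px py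
            ⊞ P≤κξ ⊞ κ* ξ≤ps ⊞ κ*≥0 ⊞ κ*≥0 ⊞ κ* κ*≥0)
            where
            κ*≥0 = κ* (δ≥0 px sx ⊞ δ≥0 py sy)
          ... | inj₂ g = by "i a bcd+ecd+*-++f-+bcd+ecd+*-++f-++bcd+ecd+*-++f-++efgh+egh+*-++f-+*+fecd+*+ecd+*++fecd+*+ecd+*++fecd+*+ecd+*++e00+e00+*-+*+i+ej*+e00+*+e00+*+ abcd+++bcd+++bcd+++egh+egh+*-+*+ej*+ecd+*+ecd+*+ecd+*+"
              (g ⊞ reach px py ⊞ reach px py ⊞ reach px py ⊞ κ* μ* (δ≥0 sx sx ⊞ δ≥0 sy sy)
            ⊞ P≤κξ ⊞ κ* ξ≤ps ⊞ κ*≥0 ⊞ κ*≥0)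
            where
            κ*≥0 = κ* (δ≥0 px sx ⊞ δ≥0 py sy)

          -- The second point is taken to be `s`. It is at distance at least ξ from `p` and from the
          -- corner, so in either alternative the last term is at least `κ * (κ * ξ)`.
          corner≤q : ∀ {q} → Pair px py W q →
            slack px py W a b + slack px py W a b + slack px py W a b ≤ q - P
          corner≤q h with h a b sx sy
          ... | inj₁ g = by "cde+fde+*-++g-+cde+fde+*-++g-++cde+fde+*-++g-++ ab-+ cde+fde+*-++g-+cde+fde+*-++g-++cde+fde+*-++g-++fchi+fhi+*-++j-+*+fjfhi+*+fhi+*+*+b+ffk**+ afchi++*+ffk**+ffhi+**+"
              (g ⊞ κ* reach px py ⊞ P≤ ⊞ κ* κ* ξ≤ps)
          ... | inj₂ g = by "cde+fde+*-++g-+cde+fde+*-++g-++cde+fde+*-++g-++ ab-+ cde+fde+*-++g-+cde+fde+*-++g-++cde+fde+*-++g-++fghi+fhi+*-++j-+*+fjfhi+*+fhi+*+*+b+ffk**+ afghi++*+ffk**+ffhi+**+"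
              (g ⊞ κ* reach a b ⊞ P≤ ⊞ κ* κ* ξ≤os)

          slack-rising : ∀ {x y} → W a b + (δ a x + δ b y) ≤ W′ x y →
            slack px py W′ x y ≤ slack px py W a b
          slack-rising {x} {y} h₁ =
              by "hij+dij+*-++k-+ abc+dbc+*-++e-+ efg++h+ij+dij+*-++d00+*+ ka+bf+cg++dbf+cg++*-++dfg+*+"
              (h₁ ⊞ onV py ⊞ μ* (δ-tri px a x ⊞ δ-tri py b y)
            ⊞ κ* (δ≥0 a x ⊞ δ≥0 b y))

          slack-dead : ∀ {x y} → W px py + (δ px x + δ py y) ≤ W′ x y → slack px py W′ x y ≤ 0r
          slack-dead {x} {y} h₁ = by "dbc+ebc+*-++f-+ 0 abc++d+e00+*+ fa+ebc+*+"
              (h₁ ⊞ onV py ⊞ κ* (δ≥0 px x ⊞ δ≥0 py y))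

          far₁ : ∀ {q} → Pair px py W q → ∀ x₁ y₁ x₂ y₂ u v L →
            ξ ≤ L → δ u x₁ + δ v y₁ ≤ L → W u v + L ≤ W′ x₁ y₁ →
            PairBound px py W′ (q - P) x₁ y₁ x₂ y₂
          far₁ h x₁ y₁ x₂ y₂ u v L ξ≤L d≤L r₁ with h u v x₂ y₂
          ... | inj₁ g = inj₁ (
              by "klm+flm+*-++n-+klm+flm+*-++n-++klm+flm+*-++n-++fkhi+fhi+*-++p-+*+ ab-+ cde+fde+*-++g-+cde+fde+*-++g-++cde+fde+*-++g-++fchi+fhi+*-++j-+*+klm+flm+*-++n-+fo*++klm+flm+*-++n-+fo*++klm+flm+*-++n-+fo*++fkhi+fhi+*-++p-+*+b+fq*+fq*+fq*+f0*+f0*+ acde+fde+*-++g-++cde+fde+*-++g-++cde+fde+*-++g-++fchi+fhi+*-++j-+*+fq*+fo*+fo*+fo*+fq*+fq*+"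
              (g ⊞ s₁ ⊞ s₁ ⊞ s₁ ⊞ κ* slack-anti x₂ y₂ ⊞ P≤κξ
                                   ⊞ κ* ξ≤L ⊞ κ* ξ≤L ⊞ κ* ξ≤L ⊞ κ* ξ≥0 ⊞ κ* ξ≥0))
            where
            s₁ : slack px py W′ x₁ y₁ + κ * L ≤ slack px py W u v
            s₁ = by "ghi+dhi+*-++l-+df*+ abc+dbc+*-++e-+ ef+g+hi+jk++dhi+jk++*-++ la+bj+ck++f+dbj+ck++f+*-++"
                (r₁ ⊞ onV py ⊞ μ* (δ-tri px u x₁ ⊞ δ-tri py v y₁ ⊞ d≤L))
          ... | inj₂ g = inj₂ (
              by "kmn+fmn+*-++v-+kmn+fmn+*-++v-++kmn+fmn+*-++v-++fvqr+fqr+*-++w-+*+ ab-+ cde+fde+*-++g-+cde+fde+*-++g-++cde+fde+*-++g-++fghi+fhi+*-++j-+*+k+k+k+gl++gl++gl+fgl+*-++mn+op++fmn+op++*-++mn+op++fmn+op++*-++mn+op++fmn+op++*-++fqr+s+t+op++fqr+s+t+op++*-+*+fj*+b+fu*+ff0**+ffu**+ ac+c+c+v+v+vfv*-++do+ep++l+fdo+ep++l+*-++do+ep++l+fdo+ep++l+*-++do+ep++l+fdo+ep++l+*-++fsh+ti++o+p+l+fsh+ti++o+p+l+*-+*+fw*+fu*+fl*+ffu**+ffl**+"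
              (g ⊞ onV py ⊞ onV py ⊞ onV py ⊞ r₁ ⊞ r₁ ⊞ μ* r₁
              ⊞ m₁ ⊞ m₁ ⊞ m₁ ⊞ κ* μ* (δ-tri x₁ u x₂ ⊞ δ-tri y₁ v y₂ ⊞ δ-sym x₁ u ⊞ δ-sym y₁ v ⊞ d≤L)
              ⊞ κ* mono x₂ y₂ ⊞ P≤κξ ⊞ κ* ξ≤L ⊞ κ* κ* ξ≥0 ⊞ κ* κ* ξ≤L))
            where
            m₁ = μ* (δ-tri px u x₁ ⊞ δ-tri py v y₁ ⊞ d≤L)

          -- The second point has weight κ, so its rise is worth only `κ * (κ * L)`; hence the bound
          -- on `P`.
          far₂ : ∀ {q} → Pair px py W q → ∀ x₁ y₁ x₂ y₂ u v L →
            ξ ≤ L → δ u x₂ + δ v y₂ ≤ L → W u v + L ≤ W′ x₂ y₂ →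
            PairBound px py W′ (q - P) x₁ y₁ x₂ y₂
          far₂ h x₁ y₁ x₂ y₂ u v L ξ≤L d≤L r₂ with h x₁ y₁ u v
          ... | inj₁ g = inj₁ (
              by "kde+fde+*-++l-+kde+fde+*-++l-++kde+fde+*-++l-++fkno+fno+*-++s-+*+ ab-+ cde+fde+*-++g-+cde+fde+*-++g-++cde+fde+*-++g-++fchi+fhi+*-++j-+*+kde+fde+*-++l-++kde+fde+*-++l-++kde+fde+*-++l-++fjm+k+no+pq++fno+pq++*-++*+b+ffr**+ acde+fde+*-++g-++cde+fde+*-++g-++cde+fde+*-++g-++fsc+hp+iq++m+fhp+iq++m+*-++*+ffr**+ffm**+"
              (g ⊞ slack-anti x₁ y₁ ⊞ slack-anti x₁ y₁ ⊞ slack-anti x₁ y₁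
              ⊞ κ* (r₂ ⊞ onV py ⊞ μ* (δ-tri px u x₂ ⊞ δ-tri py v y₂ ⊞ d≤L)) ⊞ P≤ ⊞ κ* κ* ξ≤L))
          ... | inj₂ g = inj₂ (
              by "kde+fde+*-++r-+kde+fde+*-++r-++kde+fde+*-++r-++frmn+fmn+*-++s-+*+ ab-+ cde+fde+*-++g-+cde+fde+*-++g-++cde+fde+*-++g-++fghi+fhi+*-++j-+*+k+k+k+g+g+gfg*-++fjl+mn+op++fmn+op++*-++*+b+ffq**+ ac+c+c+r+r+rfr*-++fsho+ip++l+fho+ip++l+*-++*+ffq**+ffl**+"
              (g ⊞ onV py ⊞ onV py ⊞ onV py ⊞ mono x₁ y₁ ⊞ mono x₁ y₁ ⊞ μ* mono x₁ y₁
              ⊞ κ* (r₂ ⊞ μ* (δ-tri x₁ u x₂ ⊞ δ-tri y₁ v y₂ ⊞ d≤L)) ⊞ P≤ ⊞ κ* κ* ξ≤L))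

          payQ : ∀ {q} → Pair px py W q → Pair px py W′ (q - P)
          payQ h x₁ y₁ x₂ y₂ with rising ξ≤α ξ≤β x₁ y₁ | rising ξ≤α ξ≤β x₂ y₂
          ... | far u v L ξ≤L d≤L r₁ | _ = far₁ h x₁ y₁ x₂ y₂ u v L ξ≤L d≤L r₁
          ... | _ | far u v L ξ≤L d≤L r₂ = far₂ h x₁ y₁ x₂ y₂ u v L ξ≤L d≤L r₂
          payQ h x₁ y₁ x₂ y₂ | dead r₁ | dead r₂ =
            inj₁ (by "cde+fde+*-++g-+cde+fde+*-++g-++cde+fde+*-++g-++fchi+fhi+*-++j-+*+ ab-+ cde+fde+*-++g-+cde+fde+*-++g-++cde+fde+*-++g-++fchi+fhi+*-++j-+*+b+ 00+0+f0*+a+"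
                (s₁ ⊞ s₁ ⊞ s₁ ⊞ κ* slack-dead r₂ ⊞ P≤q h))
            where s₁ = slack-dead r₁
          payQ h x₁ y₁ x₂ y₂ | corner r₁ | dead r₂ =
            inj₁ (by "cde+fde+*-++g-+cde+fde+*-++g-++cde+fde+*-++g-++fchi+fhi+*-++j-+*+ ab-+ cde+fde+*-++g-+cde+fde+*-++g-++cde+fde+*-++g-++fchi+fhi+*-++j-+*+klm+flm+*-++n-+klm+flm+*-++n-++klm+flm+*-++n-+++ klm+flm+*-++n-+klm+flm+*-++n-++klm+flm+*-++n-++f0*+ab-++"
                (s₁ ⊞ s₁ ⊞ s₁ ⊞ κ* slack-dead r₂ ⊞ corner≤q h))
            where s₁ = slack-rising r₁
          payQ {q} h x₁ y₁ x₂ y₂ | dead r₁ | corner r₂ =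
            inj₁ (by "cde+fde+*-++g-+cde+fde+*-++g-++cde+fde+*-++g-++fchi+fhi+*-++j-+*+ ab-+ cde+fde+*-++g-+cde+fde+*-++g-++cde+fde+*-++g-++fchi+fhi+*-++j-+*+fklm+flm+*-++n-+*+ 00+0+fklm+flm+*-++n-+*+ab-++"
                (s₁ ⊞ s₁ ⊞ s₁ ⊞ κ* slack-rising r₂ ⊞ bound))
            where
            s₁ = slack-dead r₁
            bound : κ * slack px py W a b ≤ q - P
            bound with ≤-total 0r (slack px py W a b)
            ... | inj₁ s≥0 = by "fcde+fde+*-++g-+* ab-+ cde+fde+*-++g-+cde+fde+*-++g-++cde+fde+*-++g-++0+0+0f0*-++ ab-+cde+fde+*-++g-++cde+fde+*-++g-++cde+fde+*-++g-+fcde+fde+*-++g-+*-++"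
                (corner≤q h ⊞ s≥0 ⊞ s≥0 ⊞ μ* s≥0)
            ... | inj₂ s≤0 = by "cdef+cef+*-++g-+* ab-+ cdef+cef+*-++g-+*b+ c0*a+" (κ* s≤0 ⊞ P≤q h)
          -- The two points are compared with each other, since comparing the second with `p` would
          -- add a slack of the corner that `corner≤q` does not cover.
          payQ h x₁ y₁ x₂ y₂ | corner r₁ | corner r₂ =
            inj₂ (by "cmn+gmn+*-++s-+cmn+gmn+*-++s-++cmn+gmn+*-++s-++gsop+gop+*-++t-+*+ ab-+ cc+c+def+++def+++def++gdef++*-++gdhi++*+jkl+gkl+*-++d-+jkl+gkl+*-++d-++jkl+gkl+*-++d-+++mn+mn++mn++gmn+mn++mn++*-++gop+q+r+gop+q+r+*-+*+g00+*+gg00+0+0+**+ jj+j+s+s+sgs*-++gt*+ab-++ke+lf++ke+lf+++ke+lf+++gke+lf++ke+lf+++ke+lf+++*-++gqh+ri++e+f+gqh+ri++e+f+*-+*+gef+*+ggef+h+i+**+"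
                (onV py ⊞ onV py ⊞ onV py ⊞ r₁ ⊞ r₁ ⊞ μ* r₁ ⊞ κ* r₂ ⊞ corner≤q h
              ⊞ μ* (m₁ ⊞ m₁ ⊞ m₁) ⊞ κ* μ* (δ-tri x₁ a x₂ ⊞ δ-tri y₁ b y₂ ⊞ δ-sym x₁ a ⊞ δ-sym y₁ b)
              ⊞ κ* (δ≥0 a x₁ ⊞ δ≥0 b y₁) ⊞ κ* κ* (δ≥0 a x₁ ⊞ δ≥0 b y₁ ⊞ δ≥0 a x₂ ⊞ δ≥0 b y₂)))
            where m₁ = δ-tri px a x₁ ⊞ δ-tri py b y₁

    -- The invariant, and its decrease by one request through `p`

    record Invariant (px py : Carrier) (W : Fun) (Ψ : Carrier) : Set where
      constructor invariant
      field
        {mV eV mH eH q} : Carrier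
        V : Half px py W mV eV
        H : Half py px (flip W) mH eH
        Q : Pair px py W q
        total : mV + eV + (mH + eH) + q ≤ Ψ

    record Position (px py : Carrier) (W : Fun) (sx sy : Carrier) : Set where
      field
        {a b} : Carrier
        supp : Supported a b W
        p∈ : px ≡ a ⊎ py ≡ b
        s∈ : sx ≡ a ⊎ sy ≡ b
        reach : Reachable W sx sy

    -- At `s`, the bound `E` has slope 1 - κ and `reach` has slope 1 - 2κ; the difference must be
    -- covered by `e`.
    worthV : ∀ {px py W sx sy m e} → Reachable W sx sy → Half px py W m e → κ * δ px sx ≤ e
    worthV {px} {sx = sx} {sy} reach h with E h sx sy
    ... | v , h₁ = by "ec* a bcd+ecd+*-++fecd+*+ecd+*++e0*+ af+bcd+++ed*+"
        (h₁ ⊞ reach px v ⊞ κ* δ≥0 v sy)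

    worthH : ∀ {px py W sx sy m e} → Reachable W sx sy → Half py px (flip W) m e → κ * δ py sy ≤ e
    worthH {py = py} {sx = sx} {sy} reach h with E h sy sx
    ... | u , h₁ = by "ec* a bcd+ecd+*-++fedc+*+edc+*++e0*+ af+bdc+++ed*+"
        (h₁ ⊞ reach u py ⊞ κ* δ≥0 u sx)

    -- The factor η makes `η * D` small against `κ * D`; the two factors κ stem from `far₂` and
    -- `corner≤q`.
    gain : Carrier → Carrier
    gain D = κ * (κ * (η * D))

    -- Both `p` and `s` lie on the previous request; on which of its lines they lie decides which
    -- bound pays.
    stepV : ∀ {px py b W W′ sx sy D Ψ} → Update px b W W′ → Position px py W sx sy →
            D ≤ δ px sx → D ≤ δ b sy → Invariant px py W Ψ → Invariant px py W′ (Ψ - gain D)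
    stepV {px} {py} {b} {W} {W′} {sx} {sy} {D} {Ψ} upd pos D≤x D≤y inv = main (≤-total D 0r) p∈ s∈
      where
      open Invariant inv
      open Position pos using (supp; p∈; s∈; reach) renaming (a to ra; b to rb)
      open Step upd
      ξ = η * D
      P = gain D

      stepH : px ≡ ra ⊎ py ≡ rb →
              ∃ λ m′ → ∃ λ e′ → (m′ + e′ ≤ mH + eH) × Half py px (flip W′) m′ e′
      stepH (inj₁ refl) = AfterV.stepH supp H
      stepH (inj₂ refl) = AfterH.stepH supp H

      idle : D ≤ 0r → Invariant px py W′ (Ψ - P)
      idle D≤0 with stepH p∈
      ... | _ , _ , sum , H′ = invariant (half-mono V) H′ (pair-mono Q) (
          by "ef+jk++i+ abbcd***-+ ef+gh++i+jk++bbcd***+ agh++bbc0***+"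
          (total ⊞ sum ⊞ κ* κ* *-monoˡ-≤ η≥0 D≤0))

      module _ (D≥0 : 0r ≤ D) where
        ξ≥0 : 0r ≤ ξ
        ξ≥0 = *-nonneg η≥0 D≥0

        κD≤D : κ * D ≤ D
        κD≤D = by "ba* a 0b0*-+ aba*-+" (μ* D≥0)

        4ξ≤κD : ξ + ξ + (ξ + ξ) ≤ κ * D
        4ξ≤κD = by "cb*cb*+cb*cb*++ ab* bcc+cc++* ba*" (*-monoˡ-≤ D≥0 4η≤κ)

        P≤ξ : P ≤ ξ
        P≤ξ = by "ccab*** ab* 0c0*-+c0c0*-+*+ ab*cab**-+cab*cab**-+*+" (μ* ξ≥0 ⊞ κ* μ* ξ≥0)

        D≤ξ⇒D≤0 : D ≤ ξ → D ≤ 0r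
        D≤ξ⇒D≤0 h = by "a 0 aa+a+a+ba*ba*+ba*ba*+++ca*+0+0+ ba*ba*+ba*+ba*+ca*+a+a+a+"
            (h ⊞ h ⊞ h ⊞ h ⊞ 4ξ≤κD ⊞ κD≤D ⊞ D≥0 ⊞ D≥0)

        afterV : px ≡ ra → sx ≡ ra ⊎ sy ≡ rb → Invariant px py W′ (Ψ - P)
        afterV refl (inj₁ refl) = idle (by "a 0 ab+ b0+" (D≤x ⊞ δ-refl px))
        afterV refl (inj₂ refl) with AfterV.stepH supp H
        ... | _ , _ , sum , H′ = invariant
          (payV {P = P} supp (by "0 abbcd***-+ be*bd*+bbcd***+ abe*+bd*+"
              (worthV reach V ⊞ κ* D≤x ⊞ P≤κD)) (by "aacd*** ab* aacd***ad*+ae*+ ad*ae*+ab*+"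
              (P≤κD ⊞ κ* D≤y ⊞ κ* δ-sym b sy)) V)
          H′ (pair-mono Q) (by "efbbcd***-++jk++i+ abbcd***-+ ef+gh++i+jk++ agh++" (total ⊞ sum))
          where
          P≤κD : P ≤ κ * D
          P≤κD = by "aacb*** ab* aacb***cb*cb*+cb*cb*+++0+0+0+ cb*ab*+cb*+cb*+cb*+"
              (P≤ξ ⊞ 4ξ≤κD ⊞ ξ≥0 ⊞ ξ≥0 ⊞ ξ≥0)

        -- If a is close to V, then e of V pays; if b is close to H, then e of H pays; otherwise
        -- every point but p and the corner rises by a multiple of D, and q pays.
        afterH : py ≡ rb → sx ≡ ra ⊎ sy ≡ rb → Invariant px py W′ (Ψ - P)
        afterH refl s∈ with ≤-total (δ ra px) ξ | ≤-total (δ b py) ξ | s∈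
        ... | inj₁ α≤ξ | _ | inj₁ refl = idle (D≤ξ⇒D≤0 (by "b ab* bc+d+ cd+ab*+"
            (D≤x ⊞ δ-sym px ra ⊞ α≤ξ)))
        ... | inj₁ α≤ξ | _ | inj₂ refl with AfterH.stepH supp H
        ...   | _ , _ , sum , H′ = invariant
          (AfterH.payV-far supp {P = P}
            (by "0 abbcd***-+ be*bd*+cd*cd*+cd*cd*+++bbcd***+0+0+0+ abe*+bd*+cd*+cd*+cd*+cd*+"
                (worthV reach V ⊞ κ* D≤x ⊞ 4ξ≤κD ⊞ P≤ξ ⊞ ξ≥0 ⊞ ξ≥0 ⊞ ξ≥0))
            (by "aadc*** ab* ac*dc*dc*+dc*dc*+++aadc***+0+0+0+ ab*ac*+dc*+dc*+dc*+dc*+"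
                (κ* D≤y ⊞ 4ξ≤κD ⊞ P≤ξ ⊞ ξ≥0 ⊞ ξ≥0 ⊞ ξ≥0))
            (by "ff+ abbcd***-+ be*bd*+cd*cd*+cd*cd*+++bbcd***+f+f+0+ abe*+bd*+cd*+cd*+cd*+cd*+"
                (worthV reach V ⊞ κ* D≤x ⊞ 4ξ≤κD ⊞ P≤ξ ⊞ α≤ξ ⊞ α≤ξ ⊞ ξ≥0)) V)
          H′ (pair-mono Q) (by "efbbcd***-++jk++i+ abbcd***-+ ef+gh++i+jk++ agh++" (total ⊞ sum))
        afterH refl s∈ | inj₂ _ | inj₁ β≤ξ | inj₂ refl =
          idle (D≤ξ⇒D≤0 (by "b ab* bc+ cab*+" (D≤y ⊞ β≤ξ)))
        afterH refl s∈ | inj₂ _ | inj₁ β≤ξ | inj₁ refl = invariant (half-mono V)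
          (AfterH.payH supp {P = P}
            (by "0 abbcd***-+ cd*cd*+cd*+bbcd***+0+0+ acd*+cd*+cd*+" (worth ⊞ P≤ξ ⊞ ξ≥0 ⊞ ξ≥0))
            (by "aaec***ff++ ab* ac*ad*+ec*ec*+ec*ec*+++aaec***+f+f+0+ ad*ab*+ac*+ec*+ec*+ec*+ec*+"
                (κ* D≤x ⊞ κ* δ-sym px ra ⊞ 4ξ≤κD ⊞ P≤ξ ⊞ β≤ξ ⊞ β≤ξ ⊞ ξ≥0))
            (by "ee+ abbcd***-+ cd*cd*+cd*+bbcd***+e+e+ acd*+cd*+cd*+" (worth ⊞ P≤ξ ⊞ β≤ξ ⊞ β≤ξ)) H)
          (pair-mono Q) (by "ef+ghbbcd***-+++i+ abbcd***-+ ef+gh++i+ a" total)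
          where
          -- The distance of `s` to H is at least D - ξ, and κ (D - ξ) ≥ 4 ξ - κ ξ ≥ 3 ξ.
          worth : ξ + ξ + ξ ≤ eH
          worth = by "gd*gd*+gd*+ a bc*bde+f+*+gd*gd*+gd*gd*+++0b0*-++ abefc++gd*+*+bd*+gd*bgd**-++"
              (worthH reach H ⊞ κ* (D≤y ⊞ δ-tri b py sy ⊞ β≤ξ) ⊞ 4ξ≤κD ⊞ μ* ξ≥0)
        afterH refl s∈ | inj₂ ξ≤α | inj₂ ξ≤β | _ with AfterH.stepH supp H
        ... | _ , _ , sum , H′ = invariant (half-mono V) H′
          (AfterH.PayPair.payQ supp {sx = sx} {sy} ξ≥0 (≤-refl P) ξ≤α ξ≤β
            (by "cd* ab+ cd*d+0+ da+b+" (ξ≤D ⊞ D≤x ⊞ δ≥0 py sy)) (by "cd* ab+ cd*d+0+ db+a+"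
                (ξ≤D ⊞ D≤y ⊞ δ≥0 ra sx)) reach Q)
          (by "ef+jk++ibbcd***-++ abbcd***-+ ef+gh++i+jk++ agh++" (total ⊞ sum))
          where
          ξ≤D : ξ ≤ D
          ξ≤D = by "ba* a ba*ba*+ba*ba*++ca*+0+0+0+ ca*a+ba*+ba*+ba*+"
              (4ξ≤κD ⊞ κD≤D ⊞ ξ≥0 ⊞ ξ≥0 ⊞ ξ≥0)

      main : D ≤ 0r ⊎ 0r ≤ D → px ≡ ra ⊎ py ≡ rb → sx ≡ ra ⊎ sy ≡ rb → Invariant px py W′ (Ψ - P)
      main (inj₁ D≤0) _ _ = idle D≤0
      main (inj₂ D≥0) (inj₁ p∈) s∈ = afterV D≥0 p∈ s∈
      main (inj₂ D≥0) (inj₂ p∈) s∈ = afterH D≥0 p∈ s∈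

    -- Exchange of the two coordinates

    flip-supported : ∀ {a b W} → Supported a b W → Supported b a (flip W)
    flip-supported supp y x with supp x y
    ... | inj₁ (v , h) = inj₂ (v , by "bdc++ a bcd++ a" h)
    ... | inj₂ (u , h) = inj₁ (u , by "bdc++ a bcd++ a" h)

    flip-update : ∀ {a b W W′} → Update a b W W′ → Update b a (flip W) (flip W′)
    flip-update upd = record
      { lip = λ y x y′ x′ → by "d abc++ d acb++" (lip x y x′ y′)
      ; lip′ = λ y x y′ x′ → by "d abc++ d acb++" (lip′ x y x′ y′)
      ; mono = flip mono ; onV = onH ; onH = onV ; supp′ = flip-supported supp′ }
      where
      open Update upd

    flip-position : ∀ {px py W sx sy} → Position px py W sx sy → Position py px (flip W) sy sx
    flip-position pos = record
      { supp = flip-supported supp ; p∈ = swap p∈ ; s∈ = swap s∈ ; reach = λ y x →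
          by "debc+*+ebc+*+ abc++ decb+*+ecb+*+ acb++" (reach x y) }
      where open Position pos

    flip-invariant : ∀ {px py W Ψ} → Invariant px py W Ψ → Invariant py px (flip W) Ψ
    flip-invariant {px} {py} {W} inv = invariant H V pair (by "de+bc++f+ a bc+de++f+ a" total)
      where
      open Invariant inv
      pair : Pair py px (flip W) q
      pair y₁ x₁ y₂ x₂ with Q x₁ y₁ x₂ y₂
      ... | inj₁ g = inj₁ (by "bdc+edc+*-++f-+bdc+edc+*-++f-++bdc+edc+*-++f-++ebhg+ehg+*-++i-+*+ a bcd+ecd+*-++f-+bcd+ecd+*-++f-++bcd+ecd+*-++f-++ebgh+egh+*-++i-+*+ a"
          g)
      ... | inj₂ g = inj₂ (by "bdc+edc+*-++f-+bdc+edc+*-++f-++bdc+edc+*-++f-++efhg+ehg+*-++i-+*+ a bcd+ecd+*-++f-+bcd+ecd+*-++f-++bcd+ecd+*-++f-++efgh+egh+*-++i-+*+ a"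
          g)

    stepH : ∀ {px py a W W′ sx sy D Ψ} → Update a py W W′ → Position px py W sx sy →
            D ≤ δ a sx → D ≤ δ py sy → Invariant px py W Ψ → Invariant px py W′ (Ψ - gain D)
    stepH upd pos D≤x D≤y inv = flip-invariant
      (stepV (flip-update upd) (flip-position pos) D≤y D≤x (flip-invariant inv))

    -- Motion of the adversary

    double : Carrier → Carrier
    double t = t + t

    -- The work function may change by 2 t because a shifted request is reached by a detour there
    -- and back, as in `closeness`.
    record Near (px py px′ py′ : Carrier) (W W′ : Fun) (t : Carrier) : Set where
      field
        lip : Lipschitz W
        close : ∀ x y → W x y ≤ W′ x y + double t
        close′ : ∀ x y → W′ x y ≤ W x y + double t
        dx : δ px px′ ≤ t
        dy : δ py py′ ≤ t

      dx′ : δ px′ px ≤ t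
      dx′ = ≤-trans (δ-sym px′ px) dx

      dy′ : δ py′ py ≤ t
      dy′ = ≤-trans (δ-sym py′ py) dy

      t≥0 : 0r ≤ t
      t≥0 = ≤-trans (δ≥0 px px′) dx

      t₈ = double (double (double t))

      at-p : W′ px′ py′ ≤ W px py + double (double t)
      at-p = by "c abb+bb+++ cd+e+f+ dbb++aef+++b+b+"
          (close′ px′ py′ ⊞ lip px′ py′ px py ⊞ dx′ ⊞ dy′)

      half : ∀ {m e} → Half px py W m e → Half px′ py′ W′ (m + t₈) (e + t₈)
      half h .M y = by "ghfh*-++ abb+bb++bb+bb++++c+ defe*-++g+hi+fhi+*-++j+k+l+m+f0*+ aj+dbb+bb++++ie+b+fie+b+*-++mkl+++b+0+cbb+++fb*+"
          (M h y ⊞ at-p ⊞ μ* (δ-tri py′ py y ⊞ dy′) ⊞ lip px y px′ y ⊞ dx ⊞ δ-refl y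
        ⊞ close px′ y ⊞ κ* t≥0)
      half h .E x y with E h x y
      ... | v , h₁ = v , by "hlf+glf+*-++ abb+bb++bb+bb++++c+ def+gef+*-++h+i+j+k+lj+glj+*-++m+g0*+0+0+ am+ibb+++djk+++b+0+je+b+gje+b+*-++cbb+++gb*+b+b+"
          (h₁ ⊞ close′ px′ v ⊞ lip px′ v px v ⊞ dx′ ⊞ δ-refl v ⊞ μ* (δ-tri px′ px x ⊞ dx′)
        ⊞ close x y ⊞ κ* t≥0 ⊞ t≥0 ⊞ t≥0)
      half h .e≥0 = by "0 abb+bb++bb+bb++++ 000+00++00++00+++ abb+bb++bb++bb+++" (e≥0 h ⊞ 8t≥0)
        where
        2t≥0 = t≥0 ⊞ t≥0
        8t≥0 = 2t≥0 ⊞ 2t≥0 ⊞ 2t≥0 ⊞ 2t≥0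

      slack-near : ∀ x y → slack px′ py′ W′ x y ≤ slack px py W x y + t₈
      slack-near x y = by "ghj+dhj+*-++l-+ abc+dbc+*-++e-+ff+ff++ff+ff++++ ge+hi+j+k+dhi+j+k+*-++d00+*+ aff+ff+++lff+++ib+f+kc++f+dib+f+kc++f+*-++dff+*+"
          (at-p ⊞ close x y ⊞ μ* (δ-tri px′ px x ⊞ dx′ ⊞ δ-tri py′ py y ⊞ dy′)
        ⊞ κ* (t≥0 ⊞ t≥0))

      -- Three slacks and one term of weight κ ≤ 1, each changing by at most 8 t, give 32 t.
      pair : ∀ {q} → Pair px py W q → Pair px′ py′ W′ (q + double (double t₈))
      pair h x₁ y₁ x₂ y₂ with h x₁ y₁ x₂ y₂
      ... | inj₁ g = inj₁ (by "klm+flm+*-++n-+klm+flm+*-++n-++klm+flm+*-++n-++fkop+fop+*-++q-+*+ abb+bb++bb+bb+++bb+bb++bb+bb++++bb+bb++bb+bb+++bb+bb++bb+bb++++++ cde+fde+*-++g-+cde+fde+*-++g-++cde+fde+*-++g-++fchi+fhi+*-++j-+*+klm+flm+*-++n-++klm+flm+*-++n-++klm+flm+*-++n-++fkop+fop+*-++q-+*+00+00++00++00++f00+00++00++00++*-++ acde+fde+*-++g-+bb+bb++bb+bb+++++cde+fde+*-++g-+bb+bb++bb+bb+++++cde+fde+*-++g-+bb+bb++bb+bb+++++fchi+fhi+*-++j-+bb+bb++bb+bb++++*+bb+bb++bb++bb++fbb+bb++bb++bb++*-++"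
          (g ⊞ s₁ ⊞ s₁ ⊞ s₁ ⊞ κ* slack-near x₂ y₂ ⊞ μ* 8t≥0))
        where
        s₁ = slack-near x₁ y₁
        2t≥0 = t≥0 ⊞ t≥0
        8t≥0 = 2t≥0 ⊞ 2t≥0 ⊞ 2t≥0 ⊞ 2t≥0
      ... | inj₂ g = inj₂ (by "klm+flm+*-++n-+klm+flm+*-++n-++klm+flm+*-++n-++fnhi+fhi+*-++o-+*+ abb+bb++bb+bb+++bb+bb++bb+bb++++bb+bb++bb+bb+++bb+bb++bb+bb++++++ cde+fde+*-++g-+cde+fde+*-++g-++cde+fde+*-++g-++fghi+fhi+*-++j-+*+klm+flm+*-++n-++klm+flm+*-++n-++klm+flm+*-++n-++fnj+00+0+0++*+00+0+0+00+0+0++f00+0+0+00+0+0++*-++ acde+fde+*-++g-+bb+bb++bb+bb+++++cde+fde+*-++g-+bb+bb++bb+bb+++++cde+fde+*-++g-+bb+bb++bb+bb+++++fgbb++obb+++bb+b+b++*+bb+b+b+bb+b+b++fbb+b+b+bb+b+b++*-++"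
          (g ⊞ s₁ ⊞ s₁ ⊞ s₁ ⊞ κ* (close′ x₁ y₁ ⊞ close x₂ y₂ ⊞ 4t≥0) ⊞ μ* (4t≥0 ⊞ 4t≥0)))
        where
        s₁ = slack-near x₁ y₁
        4t≥0 = t≥0 ⊞ t≥0 ⊞ t≥0 ⊞ t≥0

    abstract
      -- This is 64 = 4 · 8 + 32: eight for each of the four bounds of the two halves, and 32 for
      -- the pair bound.
      driftRate : Carrier
      driftRate = double (double (double (double (double (double 1r)))))

      driftRate≥0 : 0r ≤ driftRate
      driftRate≥0 = 2* 2* 2* 2* 2* 2* 1≥0
        where
        infixr 8 2*_
        2*_ : ∀ {t} → 0r ≤ t → 0r ≤ double t
        2* h = by "0 aa+ 00+ aa+" (h ⊞ h)

      driftRate-≥ : ∀ t → double (double (double (double (double (double t))))) ≤ driftRate * t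
      driftRate-≥ t = by "aa+aa++aa+aa+++aa+aa++aa+aa++++aa+aa++aa+aa+++aa+aa++aa+aa+++++aa+aa++aa+aa+++aa+aa++aa+aa++++aa+aa++aa+aa+++aa+aa++aa+aa++++++ 11+11++11+11+++11+11++11+11++++11+11++11+11+++11+11++11+11+++++11+11++11+11+++11+11++11+11++++11+11++11+11+++11+11++11+11++++++a* 0 0"
          (≤-refl 0r)

    drift : Carrier → Carrier
    drift t = driftRate * t

    perturb : ∀ {px py px′ py′ W W′ t Ψ} → Near px py px′ py′ W W′ t →
              Invariant px py W Ψ → Invariant px′ py′ W′ (Ψ + drift t)
    perturb {W = W} {W′} {t} near inv = invariant (half V) (Near.half near-flip H) (pair Q) (
        by "dcc+cc++cc+cc++++ecc+cc++cc+cc+++++fcc+cc++cc+cc++++gcc+cc++cc+cc++++++hcc+cc++cc+cc+++cc+cc++cc+cc++++cc+cc++cc+cc+++cc+cc++cc+cc+++++++ abc*+ de+fg++h+cc+cc++cc+cc+++cc+cc++cc+cc++++cc+cc++cc+cc+++cc+cc++cc+cc+++++cc+cc++cc+cc+++cc+cc++cc+cc++++cc+cc++cc+cc+++cc+cc++cc+cc+++++++ abc*+"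
        (total ⊞ driftRate-≥ t))
      where
      open Invariant inv
      open Near near
      near-flip : Near _ _ _ _ (flip W) (flip W′) _
      near-flip = record { lip = λ y x y′ x′ → by "d abc++ d acb++" (lip x y x′ y′)
                         ; close = flip close ; close′ = flip close′ ; dx = dy ; dy = dx }

  module Game
    (ℓ κ η : Carrier) (ℓ≥0 : 0r ≤ ℓ) (κ≥0 : 0r ≤ κ) (η≥0 : 0r ≤ η)
    (κ-cancel : ∀ t → κ * t ≤ 0r → t ≤ 0r)
    (ℓ+2κ≤1 : ℓ + κ + κ ≤ 1r) (4η≤κ : η + η + (η + η) ≤ κ)
    (δ : Carrier → Carrier → Carrier)
    (δ≥0 : ∀ x y → 0r ≤ δ x y)
    (δ-refl : ∀ x → δ x x ≤ 0r)
    (δ-sym : ∀ x y → δ x y ≤ δ y x)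
    (δ-tri : ∀ x y z → δ x z ≤ δ x y + δ y z)
    (δ-separated : ∀ x y → δ x y ≤ 0r → x ≡ y)
    where

    abstract
      κ+κ≤1 : κ + κ ≤ 1r
      κ+κ≤1 = by "bb+ 1 ab+b+0+ 1a+" (ℓ+2κ≤1 ⊞ ℓ≥0)

    open Potential κ η κ≥0 η≥0 κ+κ≤1 4η≤κ δ δ≥0 δ-refl δ-sym δ-tri

    -- The work function

    abstract
      min : Carrier → Carrier → Carrier
      min a b with ≤-total a b
      ... | inj₁ _ = a
      ... | inj₂ _ = b

      min≤ : ∀ a b → min a b ≤ a × min a b ≤ b
      min≤ a b with ≤-total a b
      ... | inj₁ a≤b = ≤-refl a , a≤b
      ... | inj₂ b≤a = b≤a , ≤-refl b

      min≥ : ∀ a b → a ≤ min a b ⊎ b ≤ min a b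
      min≥ a b with ≤-total a b
      ... | inj₁ _ = inj₁ (≤-refl a)
      ... | inj₂ _ = inj₂ (≤-refl b)

    -- An optimal path may move, at each request, only along the coordinate that serves it.
    abstract
      work : Carrier → Carrier → List (Carrier × Carrier) → Fun
      work ox oy [] x y = δ ox x + δ oy y
      work ox oy ((a , b) ∷ σ) x y = min (δ ox a + work a oy σ x y) (δ oy b + work ox b σ x y)

      work-nil≤ : ∀ ox oy x y → work ox oy [] x y ≤ δ ox x + δ oy y
      work-nil≤ ox oy x y = ≤-refl _

      work-nil≥ : ∀ ox oy x y → δ ox x + δ oy y ≤ work ox oy [] x y
      work-nil≥ ox oy x y = ≤-refl _

      work-left : ∀ ox oy a b σ x y → work ox oy ((a , b) ∷ σ) x y ≤ δ ox a + work a oy σ x y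
      work-left ox oy a b σ x y = proj₁ (min≤ _ _)

      work-right : ∀ ox oy a b σ x y → work ox oy ((a , b) ∷ σ) x y ≤ δ oy b + work ox b σ x y
      work-right ox oy a b σ x y = proj₂ (min≤ _ _)

      work-sel : ∀ ox oy a b σ x y →
        (δ ox a + work a oy σ x y ≤ work ox oy ((a , b) ∷ σ) x y) ⊎
        (δ oy b + work ox b σ x y ≤ work ox oy ((a , b) ∷ σ) x y)
      work-sel ox oy a b σ x y = min≥ _ _

    work≥0 : ∀ ox oy σ x y → 0r ≤ work ox oy σ x y
    work≥0 ox oy [] x y = by "0 a bc+0+0+ ab+c+" (work-nil≥ ox oy x y ⊞ δ≥0 ox x ⊞ δ≥0 oy y)
    work≥0 ox oy ((a , b) ∷ σ) x y with work-sel ox oy a b σ x y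
    ... | inj₁ h = by "0 a bc+0+0+ ab+c+" (h ⊞ δ≥0 ox a ⊞ work≥0 a oy σ x y)
    ... | inj₂ h = by "0 a bc+0+0+ ab+c+" (h ⊞ δ≥0 oy b ⊞ work≥0 ox b σ x y)

    work-lip : ∀ ox oy σ → Lipschitz (work ox oy σ)
    work-lip ox oy [] x y x′ y′ = by "d abc++ def++g+h+i+j+ gh+a+ei++fj++b+c+"
        (work-nil≤ ox oy x y ⊞ work-nil≥ ox oy x′ y′ ⊞ δ-tri ox x′ x ⊞ δ-tri oy y′ y ⊞ δ-sym x′ x ⊞ δ-sym y′ y)
    work-lip ox oy ((a , b) ∷ σ) x y x′ y′ with work-sel ox oy a b σ x′ y′
    ... | inj₁ h = by "f abc++ de+f+g+ adg++ebc+++"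
        (h ⊞ work-left ox oy a b σ x y ⊞ work-lip a oy σ x y x′ y′)
    ... | inj₂ h = by "f abc++ de+f+g+ adg++ebc+++"
        (h ⊞ work-right ox oy a b σ x y ⊞ work-lip ox b σ x y x′ y′)

    -- Both paths make the same choices; a coordinate that has served a request agrees from then on.
    work-source : ∀ ox oy ox′ oy′ σ x y →
      work ox oy σ x y ≤ δ ox ox′ + δ oy oy′ + work ox′ oy′ σ x y
    work-source ox oy ox′ oy′ [] x y = by "d ab+c+ def++g+h+ gh+c+ae++bf++"
        (work-nil≤ ox oy x y ⊞ work-nil≥ ox′ oy′ x y ⊞ δ-tri ox ox′ x ⊞ δ-tri oy oy′ y)
    work-source ox oy ox′ oy′ ((a , b) ∷ σ) x y with work-sel ox′ oy′ a b σ x y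
    ... | inj₁ h = by "f ab+c+ de+f+g+h+i+ cgh++ad++ib+e++0+"
        (h ⊞ work-left ox oy a b σ x y ⊞ δ-tri ox ox′ a ⊞ work-source a oy a oy′ σ x y
      ⊞ δ-refl a)
    ... | inj₂ h = by "f ab+c+ de+f+g+h+i+ cgh++bd++ai+e++0+"
        (h ⊞ work-right ox oy a b σ x y ⊞ δ-tri oy oy′ b ⊞ work-source ox b ox′ b σ x y
      ⊞ δ-refl b)

    -- The motion in the other coordinate can be postponed without loss, by `work-source`.
    work-serve : ∀ ox oy x y a b σ sx sy → x ≡ a ⊎ y ≡ b →
      work ox oy ((a , b) ∷ σ) sx sy ≤ δ ox x + δ oy y + work x y σ sx sy
    work-serve ox oy x y a b σ sx sy (inj₁ refl) =
      by "d ab+c+ de+f+ ae+fb+c++0+"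
          (work-left ox oy a b σ sx sy ⊞ work-source a oy a y σ sx sy ⊞ δ-refl a)
    work-serve ox oy x y a b σ sx sy (inj₂ refl) =
      by "d ab+c+ de+f+ be+af+c++0+"
          (work-right ox oy a b σ sx sy ⊞ work-source ox b x b σ sx sy ⊞ δ-refl b)

    module _ (a b : Carrier) where

      work-mono : ∀ ox oy σ x y → work ox oy σ x y ≤ work ox oy (σ ++ (a , b) ∷ []) x y
      work-mono ox oy [] x y with work-sel ox oy a b [] x y
      ... | inj₁ h = by "d a bc+d+ef++g+ agf++c+be++"
          (h ⊞ work-nil≤ ox oy x y ⊞ work-nil≥ a oy x y ⊞ δ-tri ox a x)
      ... | inj₂ h = by "d a bc+d+ef++g+ aeg++c+bf++"
          (h ⊞ work-nil≤ ox oy x y ⊞ work-nil≥ ox b x y ⊞ δ-tri oy b y)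
      work-mono ox oy ((c , e) ∷ σ) x y with work-sel ox oy c e (σ ++ (a , b) ∷ []) x y
      ... | inj₁ h = by "d a bc+d+e+ abe++c+" (h ⊞ work-left ox oy c e σ x y ⊞ work-mono c oy σ x y)
      ... | inj₂ h = by "d a bc+d+e+ abe++c+"
          (h ⊞ work-right ox oy c e σ x y ⊞ work-mono ox e σ x y)

      -- A path that ends on the line `x = a` serves the last request at its end.
      work-onV : ∀ ox oy σ y → work ox oy (σ ++ (a , b) ∷ []) a y ≤ work ox oy σ a y
      work-onV ox oy [] y = by "e a bcd++e+f+ fd+a+cb++0+"
          (work-nil≤ a oy a y ⊞ work-nil≥ ox oy a y ⊞ work-left ox oy a b [] a y ⊞ δ-refl a)
      work-onV ox oy ((c , e) ∷ σ) y with work-sel ox oy c e σ a y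
      ... | inj₁ h = by "d a bc+d+e+ abe++c+"
          (h ⊞ work-left ox oy c e (σ ++ (a , b) ∷ []) a y ⊞ work-onV c oy σ y)
      ... | inj₂ h = by "d a bc+d+e+ abe++c+"
          (h ⊞ work-right ox oy c e (σ ++ (a , b) ∷ []) a y ⊞ work-onV ox e σ y)

      work-onH : ∀ ox oy σ x → work ox oy (σ ++ (a , b) ∷ []) x b ≤ work ox oy σ x b
      work-onH ox oy [] x = by "e a bcd++e+f+ cf+a+db++0+"
          (work-nil≤ ox b x b ⊞ work-nil≥ ox oy x b ⊞ work-right ox oy a b [] x b ⊞ δ-refl b)
      work-onH ox oy ((c , e) ∷ σ) x with work-sel ox oy c e σ x b
      ... | inj₁ h = by "d a bc+d+e+ abe++c+"
          (h ⊞ work-left ox oy c e (σ ++ (a , b) ∷ []) x b ⊞ work-onH c oy σ x)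
      ... | inj₂ h = by "d a bc+d+e+ abe++c+"
          (h ⊞ work-right ox oy c e (σ ++ (a , b) ∷ []) x b ⊞ work-onH ox e σ x)

      work-supp : ∀ ox oy σ → Supported a b (work ox oy (σ ++ (a , b) ∷ []))
      work-supp ox oy [] x y with work-sel ox oy a b [] x y
      ... | inj₁ h = inj₁ (oy , by "gde++ a bc+de++f+g+h+i+ ac+hi++bf++0+0+"
          (h ⊞ work-nil≥ a oy x y ⊞ work-nil≤ a oy a oy ⊞ work-left ox oy a b [] a oy ⊞ δ-refl a ⊞ δ-refl oy))
      ... | inj₂ h = inj₂ (ox , by "gde++ a bc+de++f+g+h+i+ ac+ih++bf++0+0+"
          (h ⊞ work-nil≥ ox b x y ⊞ work-nil≤ ox b ox b ⊞ work-right ox oy a b [] ox b ⊞ δ-refl b ⊞ δ-refl ox))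
      work-supp ox oy ((c , e) ∷ σ) x y with work-sel ox oy c e (σ ++ (a , b) ∷ []) x y
      work-supp ox oy ((c , e) ∷ σ) x y | inj₁ h with work-supp c oy σ x y
      ... | inj₁ (v , h₁) = inj₁ (v , by "gef++ a bc+def+++g+ ac+bd++"
          (h ⊞ h₁ ⊞ work-left ox oy c e (σ ++ (a , b) ∷ []) a v))
      ... | inj₂ (u , h₁) = inj₂ (u , by "gef++ a bc+def+++g+ ac+bd++"
          (h ⊞ h₁ ⊞ work-left ox oy c e (σ ++ (a , b) ∷ []) u b))
      work-supp ox oy ((c , e) ∷ σ) x y | inj₂ h with work-supp ox e σ x y
      ... | inj₁ (v , h₁) = inj₁ (v , by "gef++ a bc+def+++g+ ac+bd++"
          (h ⊞ h₁ ⊞ work-right ox oy c e (σ ++ (a , b) ∷ []) a v))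
      ... | inj₂ (u , h₁) = inj₂ (u , by "gef++ a bc+def+++g+ ac+bd++"
          (h ⊞ h₁ ⊞ work-right ox oy c e (σ ++ (a , b) ∷ []) u b))

      work-update : ∀ ox oy σ → Update a b (work ox oy σ) (work ox oy (σ ++ (a , b) ∷ []))
      work-update ox oy σ = record
        { lip = work-lip ox oy σ ; lip′ = work-lip ox oy (σ ++ (a , b) ∷ []) ; mono = work-mono ox oy σ
        ; onV = work-onV ox oy σ ; onH = work-onH ox oy σ ; supp′ = work-supp ox oy σ }

    -- Where a path leaves the second request, it steps over to the first one and back.
    closeness : ∀ ox oy σ a b a′ b′ x y →
      work ox oy (σ ++ (a , b) ∷ []) x y ≤
      work ox oy (σ ++ (a′ , b′) ∷ []) x y + double (δ a a′ + δ b b′)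
    closeness ox oy σ a b a′ b′ x y with work-supp a′ b′ ox oy σ x y
    ... | inj₁ (v , h) = by "j abc+bc+++ def++g+h+i+j+k+l+m+n+0+0+ ad+gbm+++h+ikl+++n+f+0+be++c+c+"
        (h ⊞ work-mono a′ b′ ox oy σ a′ v ⊞ work-lip ox oy σ a v a′ v
      ⊞ work-onV a b ox oy σ v ⊞ work-lip ox oy (σ ++ (a , b) ∷ []) x y a v ⊞ δ-sym x a ⊞ δ-sym y v ⊞ δ-refl v
      ⊞ δ-tri a a′ x ⊞ δ≥0 b b′ ⊞ δ≥0 b b′)
    ... | inj₂ (u , h) = by "j abc+bc+++ def++g+h+i+j+k+l+m+n+0+0+ ad+gmc+++h+ikl+++e+n+0+cf++b+b+"
        (h ⊞ work-mono a′ b′ ox oy σ u b′ ⊞ work-lip ox oy σ u b u b′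
      ⊞ work-onH a b ox oy σ u ⊞ work-lip ox oy (σ ++ (a , b) ∷ []) x y u b ⊞ δ-sym x u ⊞ δ-sym y b ⊞ δ-refl u
      ⊞ δ-tri b b′ y ⊞ δ≥0 a a′ ⊞ δ≥0 a a′)

    -- The price of an adversary's move of length `t`: the drift of the potential, and the gain lost
    -- because the replaced request may be closer to the server by `t`.
    toll : Carrier → Carrier
    toll t = drift t + gain t

    initial-position : ∀ ox oy → Position ox oy (work ox oy []) ox oy
    initial-position ox oy = record
      -- A fictitious request through the origin stands for the previous one.
      { a = ox ; b = oy ; supp = λ x y → inj₁ (oy , by "bcd++ a bcd++e+f+ ef+a+0+0+"
          (work-nil≤ ox oy ox oy ⊞ work-nil≥ ox oy x y ⊞ δ-refl ox ⊞ δ-refl oy))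
      ; p∈ = inj₁ refl ; s∈ = inj₁ refl
      ; reach = λ x y → by "edbc+*+dbc+*+ abc++ bc+dd+*e+0+f+g+ bc+1*fg++a+0+0+"
          (*-monoˡ-≤ (dd x y) κ+κ≤1 ⊞ work-nil≤ ox oy ox oy ⊞ work≥0 ox oy [] x y ⊞ δ-refl ox ⊞ δ-refl oy) }
      where
      dd : ∀ x y → 0r ≤ δ x ox + δ y oy
      dd x y = by "0 ab+ 00+ ab+" (δ≥0 x ox ⊞ δ≥0 y oy)

    -- All bounds start at zero, because the distance from the origin grows with slope 1 and the
    -- slacks are measured with slope at most 1.
    initial-invariant : ∀ ox oy → Invariant ox oy (work ox oy []) 0r
    initial-invariant ox oy = invariant {mV = 0r} {0r} {0r} {0r} {0r}
      (record
        { M = λ y → by "bdfd*-++ 0a+ bcd++c+e+0+f0*+ ce+a+0+0+c+fd*+"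
            (nil≤ ox oy ⊞ nil≥ ox y ⊞ δ-refl ox ⊞ δ-refl oy ⊞ δ≥0 ox ox ⊞ κ* δ≥0 oy y)
        ; E = λ x y → y , by "bcf+gcf+*-++ 0a+ bcd++e+fgf*-++g0*+ ed+a+0+0g0*-++gc*+"
            (nil≤ ox y ⊞ nil≥ x y ⊞ δ-refl ox ⊞ μ* δ-refl y ⊞ κ* δ≥0 ox x)
        ; e≥0 = ≤-refl 0r })
      (record
        { M = λ x → by "bcfc*-++ 0a+ bcd++e+d+0+f0*+ ed+a+0+0+d+fc*+"
            (nil≤ ox oy ⊞ nil≥ x oy ⊞ δ-refl ox ⊞ δ-refl oy ⊞ δ≥0 oy oy ⊞ κ* δ≥0 ox x)
        ; E = λ y x → x , by "bdf+gdf+*-++ 0a+ bcd++e+fgf*-++g0*+ ce+a+0+0g0*-++gd*+"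
            (nil≤ x oy ⊞ nil≥ x y ⊞ δ-refl oy ⊞ μ* δ-refl x ⊞ κ* δ≥0 oy y)
        ; e≥0 = ≤-refl 0r })
      (λ x₁ y₁ x₂ y₂ → inj₁ (by "abc+dbc+*-++e-+abc+dbc+*-++e-++abc+dbc+*-++e-++dafg+dfg+*-++h-+*+ 0 abc+dbc+*-++e-+abc+dbc+*-++e-++abc+dbc+*-++e-++dafg+dfg+*-++h-+*+ 00+0+d0*+"
          (slack≤0 x₁ y₁ ⊞ slack≤0 x₁ y₁ ⊞ slack≤0 x₁ y₁ ⊞ κ* slack≤0 x₂ y₂)))
      (by "00+00++0+ 0 0 0" (≤-refl 0r))
      where
      nil≤ = work-nil≤ ox oy
      nil≥ = work-nil≥ ox oy
      slack≤0 : ∀ x y → slack ox oy (work ox oy []) x y ≤ 0r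
      slack≤0 x y = by "abc+fbc+*-++g-+ 0 abc++d+e+f00+*+ de+g+0+0+fbc+*+"
          (nil≤ ox oy ⊞ nil≥ x y ⊞ δ-refl ox ⊞ δ-refl oy ⊞ κ* (δ≥0 ox x ⊞ δ≥0 oy y))

    -- One round of the game

    module Round (ox oy : Carrier) (σ : List (Carrier × Carrier)) (a b : Carrier)
      {px py px′ py′ sx sy sx′ sy′ Ψ : Carrier} where
      W = work ox oy σ
      W′ = work ox oy (σ ++ (a , b) ∷ [])

      module _ (p∈′ : px′ ≡ a ⊎ py′ ≡ b)
        (pos : Position px py W sx sy) (inv : Invariant px py W Ψ)
        (best : ∀ x y → W′ sx′ sy′ + ℓ * (δ sx sx′ + δ sy sy′) ≤ W′ x y + ℓ * (δ sx x + δ sy y)) where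

        ℓ*_ : ∀ {a b} → a ≤ b → ℓ * a ≤ ℓ * b
        ℓ*_ = *-monoˡ-≤ ℓ≥0

        open Update (work-update a b ox oy σ)

        reach′ : ∀ x y → W′ sx′ sy′ ≤ W′ x y + ℓ * (δ x sx′ + δ y sy′)
        reach′ x y = by "e abcd+*+ ebfg+*+bhi+j+k+*+ abhi+*+bfj+gk++c+d+*+"
            (best x y ⊞ ℓ* (δ-tri sx sx′ x ⊞ δ-tri sy sy′ y ⊞ δ-sym sx′ x ⊞ δ-sym sy′ y))

        ≥0 : ∀ x y → 0r ≤ δ x sx′ + δ y sy′
        ≥0 x y = by "0 ab+ 00+ ab+" (δ≥0 x sx′ ⊞ δ≥0 y sy′)

        position : Position px′ py′ W′ sx′ sy′
        position = record
          { a = a ; b = b ; supp = supp′ ; p∈ = p∈′ ; s∈ = s∈′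
          ; reach = λ x y → by "dfbc+*+fbc+*+ abc++ dbc+ef+f+*+ aebc+*+bc+1*+" (reach′ x y
              ⊞ *-monoˡ-≤ (≥0 x y) ℓ+2κ≤1) }
          where
          -- The value at `s′` exceeds that at some point of the request by at least their distance,
          -- but by `reach′` at most by λ times it. Since λ ≤ 1 - 2κ, the point `s′` is on the
          -- request.
          s∈′ : sx′ ≡ a ⊎ sy′ ≡ b
          s∈′ with supp′ sx′ sy′
          ... | inj₁ (v , h) = inj₁ (sym (δ-separated a sx′ (κ-cancel (δ a sx′)
            (by "fb* 0 abc++d+bc+ef+f+*+f0*+f0*+f0*+ daebc+*++bc+1*+fb*+fc*+fc*+"
                (h ⊞ reach′ a v ⊞ *-monoˡ-≤ (≥0 a v) ℓ+2κ≤1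
              ⊞ κ* δ≥0 a sx′ ⊞ κ* δ≥0 v sy′ ⊞ κ* δ≥0 v sy′)))))
          ... | inj₂ (u , h) = inj₂ (sym (δ-separated b sy′ (κ-cancel (δ b sy′)
            (by "fc* 0 abc++d+bc+ef+f+*+f0*+f0*+f0*+ daebc+*++bc+1*+fc*+fb*+fb*+"
                (h ⊞ reach′ u b ⊞ *-monoˡ-≤ (≥0 u b) ℓ+2κ≤1
              ⊞ κ* δ≥0 b sy′ ⊞ κ* δ≥0 u sx′ ⊞ κ* δ≥0 u sx′)))))

        t = δ px px′ + δ py py′
        -- The distance from the server to the new request.
        D = min (δ a sx) (δ b sy)

        D≤ : D ≤ δ a sx × D ≤ δ b sy
        D≤ = min≤ _ _

        rise≤2D : W′ sx sy ≤ W sx sy + double D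
        rise≤2D with min≥ (δ a sx) (δ b sy)
        ... | inj₁ h = by "c abb++ cd+e+f+g+g+h+h+ dfg++e+ahg+++h+0+0+b+b+"
            (lip′ sx sy a sy ⊞ onV sy ⊞ lip a sy sx sy ⊞ δ-sym sx a ⊞ δ-refl sy ⊞ δ-refl sy
          ⊞ h ⊞ h)
        ... | inj₂ h = by "c abb++ cd+e+f+g+g+h+h+ dgf++e+agh+++h+0+0+b+b+"
            (lip′ sx sy sx b ⊞ onH sx ⊞ lip sx b sx sy ⊞ δ-sym sy b ⊞ δ-refl sx ⊞ δ-refl sx
          ⊞ h ⊞ h)

        -- Staying at `s` is one of the candidates in `best`.
        cost≤ : ℓ * (δ sx sx′ + δ sy sy′) + W′ sx′ sy′ ≤ W sx sy + double D
        cost≤ = by "def+*c+ abb++ cdef+*+dgh+*+i+ idgh+*+d00+*+abb+++"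
            (best sx sy ⊞ ℓ* (δ-refl sx ⊞ δ-refl sy) ⊞ rise≤2D)

        -- The request is first replaced by one through the old position of the adversary,
        -- who then follows the true request at distance at most t.
        detour : px′ ≡ a ⊎ py′ ≡ b → Invariant px′ py′ W′ (Ψ - gain (D - t) + drift t)
        detour (inj₁ refl) = perturb near (stepV (work-update px b ox oy σ) pos
          (by "bef+-+ a bc+d+0+ cda++e+f+"
              (proj₁ D≤ ⊞ δ-tri a px sx ⊞ δ-sym a px ⊞ Y)) (by "bcd+-+ a b0+0+ ac+d+"
              (proj₂ D≤ ⊞ X ⊞ Y)) inv)
          where
          X = δ≥0 px px′
          Y = δ≥0 py py′
          near : Near px py px′ py′ (work ox oy (σ ++ (px , b) ∷ [])) W′ t
          near = record
            { lip = work-lip ox oy (σ ++ (px , b) ∷ [])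
            ; close = λ x y → by "d abc+bc+++ de+e+0+0+ abe+be+++0+0+c+c+"
                (closeness ox oy σ px b a b x y ⊞ δ-refl b ⊞ δ-refl b ⊞ Y ⊞ Y)
            ; close′ = λ x y → by "d abc+bc+++ de+e+f+f+0+0+ afe+fe+++0+0+b+b+c+c+"
                (closeness ox oy σ a b px b x y ⊞ δ-refl b ⊞ δ-refl b
                ⊞ δ-sym a px ⊞ δ-sym a px ⊞ Y ⊞ Y)
            ; dx = by "a ab+ 0 b" Y ; dy = by "b ab+ 0 a" X }
        detour (inj₂ refl) = perturb near (stepH (work-update a py ox oy σ) pos
          (by "bcd+-+ a b0+0+ ac+d+" (proj₁ D≤ ⊞ X ⊞ Y)) (by "bef+-+ a bc+d+0+ cda++f+e+"
              (proj₂ D≤ ⊞ δ-tri b py sy ⊞ δ-sym b py ⊞ X)) inv)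
          where
          X = δ≥0 px px′
          Y = δ≥0 py py′
          near : Near px py px′ py′ (work ox oy (σ ++ (a , py) ∷ [])) W′ t
          near = record
            { lip = work-lip ox oy (σ ++ (a , py) ∷ [])
            ; close = λ x y → by "d abc+bc+++ de+e+0+0+ aec+ec+++0+0+b+b+"
                (closeness ox oy σ a py a b x y ⊞ δ-refl a ⊞ δ-refl a ⊞ X ⊞ X)
            ; close′ = λ x y → by "d abc+bc+++ de+e+f+f+0+0+ aef+ef+++0+0+c+c+b+b+"
                (closeness ox oy σ a b a py x y ⊞ δ-refl a ⊞ δ-refl a
                ⊞ δ-sym b py ⊞ δ-sym b py ⊞ X ⊞ X)
            ; dx = by "a ab+ 0 b" Y ; dy = by "b ab+ 0 a" X }

        -- The potential is doubled because the cost may reach 2 D / λ while one potential pays for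
        -- D only. The change of `W s` telescopes.
        round : ∃ λ Ψ′ → Invariant px′ py′ W′ Ψ′ ×
          gain (ℓ * (δ sx sx′ + δ sy sy′)) + double Ψ′ + gain (W′ sx′ sy′)
            ≤ double Ψ + double (toll t) + gain (W sx sy)
        round = _ , detour p∈′ ,
            by "eefhij+****aeeflcd+-+***-+bcd+*+aeeflcd+-+***-+bcd+*+++eefk***+ aa+bcd+*eefcd+***+bcd+*eefcd+***+++eefg***+ eefhij+*k+*** eefgll++***"
            (κ* κ* *-monoˡ-≤ η≥0 cost≤)

    -- Summation over the rounds

    pay-round : ∀ {d c G G′ Ψ Ψ′ t τ} →
      gain (ℓ * d) + double Ψ′ + G′ ≤ double Ψ + double (toll t) + G →
      gain (ℓ * c) ≤ double Ψ′ + double (toll τ) + G′ →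
      gain (ℓ * (d + c)) ≤ double Ψ + double (toll (t + τ)) + G
    pay-round h₁ h₂ = by "eefhil+**** aa+bcd+*eefcd+***+bcd+*eefcd+***+++g+ eefhi****jj++k+eefhl****+ aa+bc*eefc***+bc*eefc***+++g+jj+bd*eefd***+bd*eefd***+++k++"
        (h₁ ⊞ h₂)

    -- The potential is non-negative at the end: for `q`, both points of the pair are taken to be
    -- `p`.
    pay-nothing : ∀ {px py W w Ψ} → Invariant px py W Ψ → 0r ≤ w →
      gain (ℓ * 0r) ≤ double Ψ + double (toll 0r) + gain w
    pay-nothing {px} {py} {Ψ = Ψ} inv w≥0 =
        by "ccdf0**** aa+b0*ccd0***+b0*ccd0***+++ccde***+ 00+cc0**+ aa+ccde***+"
        (Ψ≥0 ⊞ Ψ≥0 ⊞ κ* κ* *-nonneg η≥0 w≥0)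
      where
      open Invariant inv
      μ≥0 = μ* (δ≥0 px px ⊞ δ≥0 py py)
      q≥0 : 0r ≤ q
      q≥0 with Q px py px py
      ... | inj₁ g = by "0 a bcd+ecd+*-++b-+bcd+ecd+*-++b-++bcd+ecd+*-++b-++ebcd+ecd+*-++b-+*+00+e00+*-++00+e00+*-++00+e00+*-++e00+e00+*-+*+ acd+ecd+*-++cd+ecd+*-++cd+ecd+*-++ecd+ecd+*-+*+"
          (g ⊞ μ≥0 ⊞ μ≥0 ⊞ μ≥0 ⊞ κ* μ≥0)
      ... | inj₂ g = by "0 a bcd+ecd+*-++b-+bcd+ecd+*-++b-++bcd+ecd+*-++b-++ebcd+ecd+*-++b-+*+00+e00+*-++00+e00+*-++00+e00+*-++e00+e00+*-+*+ acd+ecd+*-++cd+ecd+*-++cd+ecd+*-++ecd+ecd+*-+*+"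
          (g ⊞ μ≥0 ⊞ μ≥0 ⊞ μ≥0 ⊞ κ* μ≥0)
      Ψ≥0 : 0r ≤ Ψ
      Ψ≥0 = by "0 a bc+de++f+0+0+0+0+0+ af+b+d+c+e+"
          (total ⊞ q≥0 ⊞ m≥0 V ⊞ m≥0 H ⊞ Half.e≥0 V ⊞ Half.e≥0 H)

    extend-left : ∀ ox oy a b σ x y c → c ≤ work a oy σ x y →
      δ ox a + work a oy σ x y ≤ work ox oy ((a , b) ∷ σ) x y →
      δ ox a + δ oy oy + c ≤ work ox oy ((a , b) ∷ σ) x y
    extend-left ox oy a b σ x y c h₁ h₂ = by "ce+b+ a bcd++e+ da+0+" (h₁ ⊞ h₂ ⊞ δ-refl oy)

    extend-right : ∀ ox oy a b σ x y c → c ≤ work ox b σ x y →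
      δ oy b + work ox b σ x y ≤ work ox oy ((a , b) ∷ σ) x y →
      δ ox ox + δ oy b + c ≤ work ox oy ((a , b) ∷ σ) x y
    extend-right ox oy a b σ x y c h₁ h₂ = by "ec+b+ a bcd++e+ da+0+" (h₁ ⊞ h₂ ⊞ δ-refl ox)

    -- The work function vanishes at the origin, and `toll` is linear.
    start : ∀ ox oy {c τ} →
      gain (ℓ * c) ≤ double 0r + double (toll τ) + gain (work ox oy [] ox oy) →
      gain (ℓ * c) ≤ double (toll 1r) * τ
    start ox oy h = by "bbcef**** a1*bbc1***+a1*bbc1***++d* bbcef****bbcgh+i+***+ 00+ad*bbcd***+ad*bbcd***+++bbcg***+bbchi+0+0+***+"
        (h ⊞ κ* κ* *-monoˡ-≤ η≥0 (work-nil≤ ox oy ox oy ⊞ δ-refl ox ⊞ δ-refl oy))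

  -- From the game to the CNN problem

  module Competitive
    (ℓ κ η : Carrier) (ℓ≥0 : 0r ≤ ℓ) (κ≥0 : 0r ≤ κ) (η≥0 : 0r ≤ η)
    (κ-cancel : ∀ t → κ * t ≤ 0r → t ≤ 0r)
    (ℓ+2κ≤1 : ℓ + κ + κ ≤ 1r) (4η≤κ : η + η + (η + η) ≤ κ)
    where

    open CNN ℝ
    open Game ℓ κ η ℓ≥0 κ≥0 η≥0 κ-cancel ℓ+2κ≤1 4η≤κ
      dist dist-nonneg dist-refl dist-sym dist-tri dist-separated public
    open Potential κ η κ≥0 η≥0 κ+κ≤1 4η≤κ dist dist-nonneg dist-refl dist-sym dist-tri public

    W : Point → List Request → Fun
    W (ox , oy) σ = work ox oy σ

    work-lower : ∀ O ss σ sx sy → Serves ss σ → W O σ sx sy ≤ costTo O ss (sx , sy)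
    work-lower (ox , oy) [] [] sx sy [] = work-nil≤ ox oy sx sy
    work-lower (ox , oy) ((x , y) ∷ ss) ((a , b) ∷ σ) sx sy (s∈r ∷ serves) =
      ≤-trans (work-serve ox oy x y a b σ sx sy s∈r)
              (≤-refl (d (ox , oy) (x , y)) ⊞ work-lower (x , y) ss σ sx sy serves)

    work-attained : ∀ O σ sx sy → ∃ λ ss → Serves ss σ × costTo O ss (sx , sy) ≤ W O σ sx sy
    work-attained (ox , oy) [] sx sy = [] , [] , work-nil≥ ox oy sx sy
    work-attained (ox , oy) ((a , b) ∷ σ) sx sy with work-sel ox oy a b σ sx sy
    ... | inj₁ h = let ss , serves , c≤ = work-attained (a , oy) σ sx sy in
      (a , oy) ∷ ss , inj₁ refl ∷ serves , extend-left ox oy a b σ sx sy _ c≤ h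
    ... | inj₂ h = let ss , serves , c≤ = work-attained (ox , b) σ sx sy in
      (ox , b) ∷ ss , inj₂ refl ∷ serves , extend-right ox oy a b σ sx sy _ c≤ h

    isWork : ∀ O σ sx sy → IsWork O σ (sx , sy) (W O σ sx sy)
    isWork O σ sx sy with work-attained O σ sx sy
    ... | ss , serves , c≤ =
      (ss , serves , ≤-antisym c≤ (work-lower O ss σ sx sy serves)) ,
      λ ss′ serves′ → work-lower O ss′ σ sx sy serves′

    isWork-unique : ∀ {O σ sx sy w} → IsWork O σ (sx , sy) w → w ≡ W O σ sx sy
    isWork-unique {O} {σ} {sx} {sy} ((ss , serves , refl) , least)
      with isWork O σ sx sy
    ... | (ss′ , serves′ , eq) , least′ =
      ≤-antisym (subst (_ ≤_) eq (least ss′ serves′)) (least′ ss serves)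

    -- The adversary follows an arbitrary serving path `ss` from `p`; an optimal one is inserted in
    -- `total-cost`.
    run-cost : ∀ {ox oy σ sx sy px py ρ cost Ψ} ss →
      WFARun ℓ (ox , oy) σ (sx , sy) ρ cost → Serves ss ρ →
      Position px py (work ox oy σ) sx sy → Invariant px py (work ox oy σ) Ψ →
      gain (ℓ * cost) ≤ double Ψ + double (toll (pathCost (px , py) ss)) + gain (work ox oy σ sx sy)
    run-cost {ox} {oy} {σ} {sx} {sy} [] done [] pos inv = pay-nothing inv (work≥0 ox oy σ sx sy)
    run-cost {ox} {oy} {σ} {sx} {sy} ((px′ , py′) ∷ ss)
      (step {r = a , b} {s′ = sx′ , sy′} (w , isW , least) run) (p∈ ∷ serves) pos inv =
      pay-round (proj₂ (proj₂ next)) (run-cost ss run serves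
        (Round.position ox oy σ a b p∈ pos inv best) (proj₁ (proj₂ next)))
      where
      best : ∀ x y →
        work ox oy (σ ++ [ a , b ]) sx′ sy′ + ℓ * (dist sx sx′ + dist sy sy′) ≤
        work ox oy (σ ++ [ a , b ]) x y + ℓ * (dist sx x + dist sy y)
      best x y = subst (λ w → w + _ ≤ _) (isWork-unique isW)
        (least (x , y) _ (isWork (ox , oy) (σ ++ [ a , b ]) x y))
      next = Round.round ox oy σ a b p∈ pos inv best

    pathCost-nonneg : ∀ O ss → 0r ≤ pathCost O ss
    pathCost-nonneg O [] = ≤-refl 0r
    pathCost-nonneg (ox , oy) ((x , y) ∷ ss) =
      by "0 ab+c+ 00+0+ ab+c+" (dist-nonneg ox x ⊞ dist-nonneg oy y ⊞ pathCost-nonneg (x , y) ss)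

    double-nonneg : ∀ {t} → 0r ≤ t → 0r ≤ double t
    double-nonneg h = by "0 aa+ 00+ aa+" (h ⊞ h)

    toll-nonneg : ∀ {t} → 0r ≤ t → 0r ≤ toll t
    toll-nonneg t≥0 = by "0 ab*ccdb***+ 00+ ab*ccdb***+"
        (*-nonneg driftRate≥0 t≥0 ⊞ *-nonneg κ≥0 (*-nonneg κ≥0 (*-nonneg η≥0 t≥0)))

    total-cost : ∀ O ρ cost opt → WFARun ℓ O [] O ρ cost → IsOpt O ρ opt →
      gain (ℓ * cost) ≤ double (toll 1r) * opt
    total-cost (ox , oy) ρ cost opt run ((ss , serves , refl) , _) = start ox oy
      (run-cost ss run serves (initial-position ox oy) (initial-invariant ox oy))

-- Choice of the constants, and the competitive ratio

theorem1 : (ℝ : RealField) → let open RealField ℝ in let open CNN ℝ in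
    (λ′ : Carrier) → 0r < λ′ → λ′ < 1r →
    ∃ λ c → ∃ λ c₀ → (1r ≤ c) ×
    (∀ (O : Point) (ρ : List Request) (cost opt : Carrier) →
    WFARun λ′ O [] O ρ cost → IsOpt O ρ opt →
    cost ≤ c * opt + c₀)
theorem1 ℝ ℓ (ℓ≥0 , 0≢ℓ) (ℓ≤1 , ℓ≢1) = 1r + ratio , 0r , 1≤1+ ratio≥0 , bound
  where
  open RealField ℝ
  open CNN ℝ
  open Reals ℝ
  open Field ℝ
  open OrderedField ℝ

  invert : ∀ x → x ≢ 0r → 0r ≤ x → ∃ λ y → x * y ≡ 1r × 0r ≤ y
  invert x x≢0 x≥0 with *-inverse x x≢0
  ... | y , eq = y , eq , inverse-nonneg x y eq x≥0

  2≥0 : 0r ≤ 2r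
  2≥0 = by "0 11+ 00+ 11+" (1≥0 ⊞ 1≥0)

  half = invert 2r 2≢0 2≥0
  h = proj₁ half
  2h≡1 = proj₁ (proj₂ half)
  h≥0 = proj₂ (proj₂ half)

  -- With `h` = 1/2 these are (1 - λ)/2 and κ/4, the largest values that `ℓ+2κ≤1` and `4η≤κ` allow.
  κ η : Carrier
  κ = (1r - ℓ) * h
  η = κ * h * h

  1-ℓ≥0 : 0r ≤ 1r - ℓ
  1-ℓ≥0 = by "0 1a-+ a 1" ℓ≤1
  κ≥0 : 0r ≤ κ
  κ≥0 = *-nonneg 1-ℓ≥0 h≥0
  η≥0 : 0r ≤ η
  η≥0 = *-nonneg (*-nonneg κ≥0 h≥0) h≥0

  ℓ+2κ≤1 : ℓ + κ + κ ≤ 1r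
  ℓ+2κ≤1 = by "a1a-+b*+1a-+b*+ 1 1a-+11+b** 1a-+1*" (*-monoˡ-≤ 1-ℓ≥0 (≡⇒≤ 2h≡1))

  1≤ℓ+2κ : 1r ≤ ℓ + κ + κ
  1≤ℓ+2κ = by "1 a1a-+b*+1a-+b*+ 1a-+1* 1a-+11+b**" (*-monoˡ-≤ 1-ℓ≥0 (≡⇒≤ (sym 2h≡1)))

  κ≤4η : κ ≤ η + η + (η + η)
  κ≤4η = by "1a-+b* 1a-+b*b*b*1a-+b*b*b*+1a-+b*b*b*1a-+b*b*b*++ 1a-+b*1*1a-+b*11+b**1*+ 1a-+b*11+b**1a-+b*11+b**11+b**+"
      (*-monoˡ-≤ κ≥0 (≡⇒≤ (sym 2h≡1)) ⊞ *-monoˡ-≤ (*-nonneg κ≥0 (*-nonneg 2≥0 h≥0)) (≡⇒≤ (sym 2h≡1)))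

  4η≤κ : η + η + (η + η) ≤ κ
  4η≤κ = by "1a-+b*b*b*1a-+b*b*b*+1a-+b*b*b*1a-+b*b*b*++ 1a-+b* 1a-+b*11+b**1a-+b*11+b**11+b**+ 1a-+b*1*1a-+b*11+b**1*+"
      (*-monoˡ-≤ κ≥0 (≡⇒≤ 2h≡1) ⊞ *-monoˡ-≤ (*-nonneg κ≥0 (*-nonneg 2≥0 h≥0)) (≡⇒≤ 2h≡1))

  κ≢0 : κ ≢ 0r
  κ≢0 eq = ℓ≢1 (≤-antisym ℓ≤1 (by "1 a 11a-+b*+1a-+b*+ a1a-+b*+1a-+b*+0+0+"
      (1≤ℓ+2κ ⊞ ≡⇒≤ eq ⊞ ≡⇒≤ eq)))

  η≢0 : η ≢ 0r
  η≢0 eq = κ≢0 (≤-antisym (by "1a-+b* 0 1a-+b*1a-+b*b*b*+1a-+b*b*b*+1a-+b*b*b*+1a-+b*b*b*+ 1a-+b*b*b*1a-+b*b*b*+1a-+b*b*b*1a-+b*b*b*++0+0+0+0+"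
      (κ≤4η ⊞ η≤0 ⊞ η≤0 ⊞ η≤0 ⊞ η≤0)) κ≥0)
    where η≤0 = ≡⇒≤ eq

  ℓ⁻¹ = invert ℓ (λ eq → 0≢ℓ (sym eq)) ℓ≥0
  κ⁻¹ = invert κ κ≢0 κ≥0
  η⁻¹ = invert η η≢0 η≥0

  κ-cancel : ∀ t → κ * t ≤ 0r → t ≤ 0r
  κ-cancel t h = by "a 0 a b0*" (divide (proj₁ (proj₂ κ⁻¹)) (proj₂ (proj₂ κ⁻¹)) h)

  open Analysis.Competitive ℝ ℓ κ η ℓ≥0 κ≥0 η≥0 κ-cancel ℓ+2κ≤1 4η≤κ

  k = proj₁ κ⁻¹
  κk≡1 = proj₁ (proj₂ κ⁻¹)
  k≥0 = proj₂ (proj₂ κ⁻¹)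
  -- This is 2 `toll 1r` / (λ η κ²), the bound of `total-cost` divided by the factors of `gain` and
  -- by λ.
  ratio = proj₁ ℓ⁻¹ * (proj₁ η⁻¹ * (k * (k * double (toll 1r))))

  ratio≥0 : 0r ≤ ratio
  ratio≥0 = *-nonneg (proj₂ (proj₂ ℓ⁻¹)) (*-nonneg (proj₂ (proj₂ η⁻¹)) (*-nonneg k≥0 (*-nonneg k≥0
    (double-nonneg (toll-nonneg 1≥0)))))

  bound : ∀ (O : Point) (ρ : List Request) (cost opt : Carrier) →
    WFARun ℓ O [] O ρ cost → IsOpt O ρ opt → cost ≤ (1r + ratio) * opt + 0r
  bound O ρ cost opt run isOpt@((ss , _ , refl) , _) = regroup (pathCost-nonneg O ss)
    (divide (proj₁ (proj₂ ℓ⁻¹)) (proj₂ (proj₂ ℓ⁻¹)) (divide (proj₁ (proj₂ η⁻¹)) (proj₂ (proj₂ η⁻¹))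
      (divide κk≡1 k≥0 (divide κk≡1 k≥0 (total-cost O ρ cost opt run isOpt)))))
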